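{- Let $T$ be an $r$-row non-skew fluctuating tableau of length $n$, let $1\le u\le n$ and $1\le j\le n-1$, and let $v\in[n]$ with $v\equiv u+j\pmod n$. Let $w_0w_1\cdots w_{n-1}$ be the lattice word of $\mathcal P^{u-1}(T)$, and apply to $w_1\cdots w_{n-1}$ any sequence of raising operators (each application nonzero) ending at a highest weight word. Then for each $1\le i\le r-1$, $\overline{\mathbf M}^i(T)_{u,v}$ equals the number of times the operator $e_i$ is applied to the letter in position $j$.
   Context: Let $\mathcal A_r$ be the set of subsets $S\subseteq\{\pm1,\ldots,\pm r\}$ with all elements of the same sign (including $\emptyset$); $\mathbf e_S=\sum_{s\in S}\mathbf e_s$ if $S$ is positive and $\mathbf e_S=-\sum_{s\in S}\mathbf e_{ -s}$ if negative ($\mathbf e_1,\ldots,\mathbf e_r$ standard basis of $\mathbb Z^r$). An $r$-row non-skew fluctuating tableau of length $n$ is a sequence $0=\lambda^0,\ldots,\lambda^n$ of weakly decreasing vectors in $\mathbb Z^r$ with $\lambda^k=\lambda^{k-1}+\mathbf e_{S_k}$, $S_k\in\mathcal A_r$; its lattice word is $S_1\cdots S_n$ (0-indexed here). $\mathrm{sort}(\alpha)$ is the weakly decreasing rearrangement. The promotion–evacuation diagram of $T$ is $(\lambda^{i,j})_{0\le i\le n,\,i\le j\le n+i}$ with $\lambda^{0,j}=\lambda^j$, $\lambda^{i,i}=\lambda^0$, $\lambda^{i,n+i}=\lambda^n$, and $\lambda^{i,j}=\mathrm{sort}(\lambda^{i-1,j}+\lambda^{i,j-1}-\lambda^{i-1,j-1})$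 for $1\le i\le n$, $i<j<n+i$ (increasing $i$, then $j$). Promotion is $\mathcal P(T)=(\lambda^{1,1},\ldots,\lambda^{1,n+1})$. Reduced promotion matrices (off-diagonal entries): for $u\ne v$ in $[n]$, let $j'=v$ if $u<v$ and $j'=v+n$ if $u>v$, and define $A,B\in\mathcal A_r$ by $\lambda^{u-1,j'-1}=\lambda^{u,j'-1}+\mathbf e_A$ and $\lambda^{u-1,j'}=\lambda^{u,j'}+\mathbf e_B$. Then $\overline{\mathbf M}^i(T)_{uv}$ ($1\le i\le r-1$) are the unique integers with $\mathbf e_B=\mathbf e_A+\sum_{i=1}^{r-1}\overline{\mathbf M}^i(T)_{uv}(\mathbf e_{i+1}-\mathbf e_i)$. (This is equivalent to the paper's definition as the number of entries containing $i$ in block $(u,v)$ of the promotion matrix.) Raising operators (bracketing rule), $1\le i\le r-1$, on words in $\mathcal A_r$: write "[" under each letter containing $i$ but not $i+1$, or $-(i+1)$ but not $-i$; write "]" under each letter containing $i+1$ but not $i$, or $-i$ but not $-(i+1)$; match brackets from the inside out. $e_i$ acts on the letter with the rightmost unmatched "]" by replacing $i+1$ with $i$, or $-i$ with $-(i+1)$; it gives $0$ if no "]" is unmatched. A word is highest weight if every $e_i$ gives $0$. -}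

module Defs where

open import Data.Bool using (Bool; true; false; not; _∧_; _∨_; if_then_else_)
open import Data.Nat as ℕ using (ℕ; zero; suc; _∸_; _<ᵇ_; _≡ᵇ_)
open import Data.Integer as ℤ using (ℤ; +_; _≤ᵇ_)
open import Data.List using (List; []; _∷_; zipWith; map; replicate; scanl; foldr; upTo; length)
open import Data.List.Relation.Unary.Linked using (Linked)
open import Data.List.Relation.Unary.All using (All)
open import Data.Vec as Vec using (Vec; []; _∷_; toList)
open import Data.Maybe using (Maybe; just; nothing)
open import Data.Product using (Σ; _×_; _,_)
open import Relation.Binary.PropositionalEquality using (_≡_)

-- Vectors in ℤ^r are represented as lists of integers (length r).

_⊕_ : List ℤ → List ℤ → List ℤ
_⊕_ = zipWith ℤ._+_

_⊖_ : List ℤ → List ℤ → List ℤ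
_⊖_ = zipWith ℤ._-_

scale : ℤ → List ℤ → List ℤ
scale c = map (c ℤ.*_)

zeroVec : ℕ → List ℤ
zeroVec r = replicate r (+ 0)

-- standard basis vector e_k of ℤ^r, k ∈ {1,…,r} (1-indexed)
unitVec : ℕ → ℕ → List ℤ
unitVec zero k = []
unitVec (suc r) (suc zero) = + 1 ∷ zeroVec r
unitVec (suc r) zero = + 0 ∷ unitVec r zero
unitVec (suc r) (suc (suc k)) = + 0 ∷ unitVec r (suc k)

insertDec : ℤ → List ℤ → List ℤ
insertDec x [] = x ∷ []
insertDec x (y ∷ ys) = if y ≤ᵇ x then x ∷ y ∷ ys else y ∷ insertDec x ys

sort : List ℤ → List ℤ
sort = foldr insertDec []

WeaklyDecreasing : List ℤ → Set
WeaklyDecreasing = Linked (λ a b → b ℤ.≤ a)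

-- Letters: elements of 𝒜_r.  A letter is a sign together with a subset
-- of {1,…,r} (bit k-1 of `elems` says whether k, resp. -k, is in S).
-- neg = false: S = {k : k ∈ elems} ⊆ {1..r};
-- neg = true : S = {-k : k ∈ elems} ⊆ {-1..-r}.
-- (The empty set has two representations; they behave identically.)

record Letter (r : ℕ) : Set where
  constructor letter
  field
    neg   : Bool
    elems : Vec Bool r
open Letter public

-- membership of k ∈ {1..r} (1-indexed); false outside range
memb : ∀ {r} → ℕ → Vec Bool r → Bool
memb zero _ = false
memb (suc k) [] = false
memb (suc zero) (b ∷ bs) = b
memb (suc (suc k)) (b ∷ bs) = memb (suc k) bs

setBit : ∀ {r} → ℕ → Bool → Vec Bool r → Vec Bool r
setBit zero _ bs = bs
setBit (suc k) _ [] = []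
setBit (suc zero) c (b ∷ bs) = c ∷ bs
setBit (suc (suc k)) c (b ∷ bs) = b ∷ setBit (suc k) c bs

hasPos : ∀ {r} → ℕ → Letter r → Bool
hasPos k x = not (neg x) ∧ memb k (elems x)

hasNeg : ∀ {r} → ℕ → Letter r → Bool
hasNeg k x = neg x ∧ memb k (elems x)

eVec : ∀ {r} → Letter r → List ℤ
eVec x = toList (Vec.map (λ b → if b then (if neg x then ℤ.-[1+ 0 ] else + 1) else + 0) (elems x))

lambdas : ∀ {r} → List (Letter r) → List (List ℤ)
lambdas {r} w = scanl (λ acc x → acc ⊕ eVec x) (zeroVec r) w

IsNonSkewFT : (r n : ℕ) → List (List ℤ) → Set
IsNonSkewFT r n T =
  Σ (List (Letter r)) λ w → length w ≡ n × lambdas w ≡ T × All WeaklyDecreasing T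

IsLatticeWord : ∀ {r} → List (Letter r) → List (List ℤ) → Set
IsLatticeWord w T = lambdas w ≡ T

-- Given row i-1 (λ^{i-1,i-1}, …, λ^{i-1,n+i-1}) compute row i
-- (λ^{i,i}, …, λ^{i,n+i}) :  λ^{i,i} = λ^0, λ^{i,n+i} = λ^n and
-- λ^{i,j} = sort(λ^{i-1,j} + λ^{i,j-1} - λ^{i-1,j-1}) for i<j<n+i.
private
  go : List ℤ → List (List ℤ) → List (List ℤ)
  go q [] = []
  go q (pn ∷ []) = pn ∷ []
  go q (pk ∷ tl@(pk1 ∷ _)) = qk ∷ go qk tl
    where qk = sort ((pk1 ⊕ q) ⊖ pk)

promote : List (List ℤ) → List (List ℤ)
promote [] = []
promote (p0 ∷ rest) = p0 ∷ go p0 rest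

iter : {A : Set} → ℕ → (A → A) → A → A
iter zero f a = a
iter (suc k) f a = f (iter k f a)

at : {A : Set} → A → List A → ℕ → A
at d [] _ = d
at d (x ∷ xs) zero = x
at d (x ∷ xs) (suc k) = at d xs k

diag : List (List ℤ) → ℕ → ℕ → List ℤ
diag T i j = at [] (iter i promote T) (j ∸ i)

-- c : ℕ → ℤ gives the reduced promotion matrix entries
-- c i = M̄^i(T)_{uv} (1 ≤ i ≤ r-1), i.e. they satisfy
--   e_B = e_A + Σ_{i=1}^{r-1} c i (e_{i+1} - e_i)
-- where λ^{u-1,j'-1} = λ^{u,j'-1} + e_A, λ^{u-1,j'} = λ^{u,j'} + e_B.
-- (These integers are unique, so this characterizes M̄^i(T)_{uv}.)
IsReducedM : (r n : ℕ) → List (List ℤ) → (u v : ℕ) → (ℕ → ℤ) → Set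
IsReducedM r n T u v c = eB ≡ eA ⊕ combo
  where
    j' : ℕ
    j' = if u <ᵇ v then v else v ℕ.+ n
    eA = diag T (u ∸ 1) (j' ∸ 1) ⊖ diag T u (j' ∸ 1)
    eB = diag T (u ∸ 1) j' ⊖ diag T u j'
    combo = foldr (λ i acc → scale (c i) (unitVec r (suc i) ⊖ unitVec r i) ⊕ acc)
                  (zeroVec r) (map suc (upTo (r ∸ 1)))

data Bracket : Set where
  opn cls none : Bracket

bracket : ∀ {r} → ℕ → Letter r → Bracket
bracket i x =
  if (hasPos i x ∧ not (hasPos (suc i) x)) ∨ (hasNeg (suc i) x ∧ not (hasNeg i x))
  then opn
  else (if (hasPos (suc i) x ∧ not (hasPos i x)) ∨ (hasNeg i x ∧ not (hasNeg (suc i) x))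
        then cls else none)

-- position (0-indexed) of the rightmost unmatched "]" ;
-- arguments: current index, number of currently unmatched "[", best so far
rightmostUnmatched : ∀ {r} → ℕ → List (Letter r) → ℕ → ℕ → Maybe ℕ → Maybe ℕ
rightmostUnmatched i [] idx k m = m
rightmostUnmatched i (x ∷ xs) idx k m with bracket i x
... | opn = rightmostUnmatched i xs (suc idx) (suc k) m
... | none = rightmostUnmatched i xs (suc idx) k m
... | cls with k
...   | zero = rightmostUnmatched i xs (suc idx) zero (just idx)
...   | suc k' = rightmostUnmatched i xs (suc idx) k' m

act : ∀ {r} → ℕ → Letter r → Letter r
act i (letter false es) = letter false (setBit i true (setBit (suc i) false es))
act i (letter true es)  = letter true (setBit (suc i) true (setBit i false es))

applyAt : {A : Set} → ℕ → (A → A) → List A → List A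
applyAt _ f [] = []
applyAt zero f (x ∷ xs) = f x ∷ xs
applyAt (suc p) f (x ∷ xs) = x ∷ applyAt p f xs

-- e_i w : nothing means 0; otherwise the position acted on and the result
raise : ∀ {r} → ℕ → List (Letter r) → Maybe (ℕ × List (Letter r))
raise i w with rightmostUnmatched i w 0 0 nothing
... | nothing = nothing
... | just p = just (p , applyAt p (act i) w)

applySeq : ∀ {r} → List ℕ → List (Letter r) → Maybe (List (ℕ × ℕ) × List (Letter r))
applySeq [] w = just ([] , w)
applySeq (i ∷ is) w with raise i w
... | nothing = nothing
... | just (p , w₁) with applySeq is w₁
...   | nothing = nothing
...   | just (lg , w₂) = just ((i , p) ∷ lg , w₂)

HighestWeight : (r : ℕ) → List (Letter r) → Set
HighestWeight r w = ∀ i → 1 ℕ.≤ i → i ℕ.≤ r ∸ 1 → raise i w ≡ nothing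

countApps : ℕ → ℕ → List (ℕ × ℕ) → ℕ
countApps i p [] = 0
countApps i p ((i' , p') ∷ lg) =
  if (i ≡ᵇ i') ∧ (p ≡ᵇ p') then suc (countApps i p lg) else countApps i p lg

{-# OPTIONS --safe #-}
module Submission where

-- Let μ be row u−1, with lattice word x y, and let ν be row u.  The recursion for ν reads
-- ν^k = sort(ν^{k−1} + e_{y_k}), and e_A, e_B are consecutive terms of the sequence μ^{k+1} − ν^k.
-- Hence the claim says that the highest weight word reached from y is the lattice word of ν.
--
-- Let p_k be the prefix weights of a word reached from y and χ_k = μ^{k+1} − p_k, so that χ_k = e_x
-- for all k at the start.  All χ_k keep their entries in {0, 1} (or in {−1, 0}, if x is negative):
-- applying e_i to letter q subtracts e_i − e_{i+1} from χ_k for k > q, and each of these χ_k has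
-- the larger value at i and the smaller one at i+1, because once e_i has acted on a letter, none of
-- e_{i−1}, e_i, e_{i+1} acts on an earlier letter.  For the same reason each letter y_k has, at the end,
-- been moved only within blocks on which p_k is constant.  As p_{k+1} is weakly decreasing by then,
-- p_{k+1} = sort(p_k + e_{y_k}), which is the recursion for ν.

open import Defs
open import Data.Bool using (Bool; true; false; T; _∧_; if_then_else_)
open import Data.Bool.Properties using (∧-zeroʳ)
open import Data.Integer as ℤ using (ℤ; +_; -[1+_]; _-_)
open import Data.Integer.Divisibility using (_∣_)
import Data.Integer.Properties as ℤₚ
open import Data.Integer.Tactic.RingSolver using (solve-∀)
open import Data.List using (List; []; _∷_; length; zipWith; scanl; foldr; map; upTo; applyUpTo; drop)
import Data.List.Properties as Listₚ
open import Data.List.Relation.Unary.All as All using (All; []; _∷_)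
open import Data.List.Relation.Unary.All.Properties using (applyUpTo⁺₁; applyUpTo⁺₂)
open import Data.List.Relation.Unary.Linked using ([]; [-]; _∷_)
open import Data.Maybe using (Maybe; just; nothing)
open import Data.Nat as ℕ using (ℕ; zero; suc; _+_; _∸_; _≤_; _<_; z≤n; s≤s; _≡ᵇ_)
import Data.Nat.Divisibility as ℕᵈ
import Data.Nat.Properties as ℕₚ
open import Data.Product using (∃; _×_; _,_; proj₁; proj₂)
open import Data.Sum using (_⊎_; inj₁; inj₂)
open import Data.Vec as Vec using (Vec; []; _∷_)
import Data.Vec.Properties as Vecₚ
open import Relation.Binary.Definitions using (tri<; tri≈; tri>)
open import Relation.Binary.PropositionalEquality
  using (_≡_; _≢_; refl; sym; trans; cong; cong₂; subst; subst₂; module ≡-Reasoning)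
open import Relation.Nullary using (¬_; yes; no; contradiction)
open import Relation.Nullary.Decidable using (does; dec-true; dec-false)

-- Insertion sort.

insertDec-≤ : ∀ {x y} → y ℤ.≤ x → ∀ l → insertDec x (y ∷ l) ≡ x ∷ y ∷ l
insertDec-≤ {x} {y} y≤x l with y ℤ.≤ᵇ x | ℤₚ.≤⇒≤ᵇ y≤x
... | true | _ = refl

insertDec-> : ∀ {x y} → x ℤ.< y → ∀ l → insertDec x (y ∷ l) ≡ y ∷ insertDec x l
insertDec-> {x} {y} x<y l with y ℤ.≤ᵇ x in eq
... | false = refl
... | true = contradiction (ℤₚ.≤ᵇ⇒≤ (subst T (sym eq) _)) (ℤₚ.<⇒≱ x<y)

≤-or-> : ∀ x y → (y ℤ.≤ x) ⊎ (x ℤ.< y)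
≤-or-> x y with y ℤ.≤? x
... | yes p = inj₁ p
... | no p = inj₂ (ℤₚ.≰⇒> p)

-- Equal values make both sides identical, so `y < x` may be assumed; then both insertions are
-- followed past each head `z`. This is all of the permutation invariance of `sort` that is used,
-- since a raising operator swaps adjacent entries.
insertDec-comm-≤ : ∀ {x y} → y ℤ.≤ x → ∀ l →
  insertDec x (insertDec y l) ≡ insertDec y (insertDec x l)
insertDec-comm-≤ {x} {y} y≤x l with ≤-or-> y x
... | inj₁ x≤y with refl ← ℤₚ.≤-antisym x≤y y≤x = refl
insertDec-comm-≤ {x} {y} y≤x [] | inj₂ y<x = trans (insertDec-≤ y≤x []) (sym (insertDec-> y<x []))
insertDec-comm-≤ {x} {y} y≤x (z ∷ l) | inj₂ y<x with ≤-or-> y z | ≤-or-> x z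
... | inj₁ z≤y | inj₂ x<z = contradiction (ℤₚ.≤-trans z≤y y≤x) (ℤₚ.<⇒≱ x<z)
... | inj₁ z≤y | inj₁ z≤x = begin
  insertDec x (insertDec y (z ∷ l)) ≡⟨ cong (insertDec x) (insertDec-≤ z≤y l) ⟩
  insertDec x (y ∷ z ∷ l)           ≡⟨ insertDec-≤ y≤x (z ∷ l) ⟩
  x ∷ y ∷ z ∷ l                     ≡⟨ cong (x ∷_) (insertDec-≤ z≤y l) ⟨
  x ∷ insertDec y (z ∷ l)           ≡⟨ insertDec-> y<x (z ∷ l) ⟨
  insertDec y (x ∷ z ∷ l)           ≡⟨ cong (insertDec y) (insertDec-≤ z≤x l) ⟨
  insertDec y (insertDec x (z ∷ l)) ∎
  where open ≡-Reasoning
... | inj₂ y<z | inj₁ z≤x = begin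
  insertDec x (insertDec y (z ∷ l)) ≡⟨ cong (insertDec x) (insertDec-> y<z l) ⟩
  insertDec x (z ∷ insertDec y l)   ≡⟨ insertDec-≤ z≤x (insertDec y l) ⟩
  x ∷ z ∷ insertDec y l             ≡⟨ cong (x ∷_) (insertDec-> y<z l) ⟨
  x ∷ insertDec y (z ∷ l)           ≡⟨ insertDec-> y<x (z ∷ l) ⟨
  insertDec y (x ∷ z ∷ l)           ≡⟨ cong (insertDec y) (insertDec-≤ z≤x l) ⟨
  insertDec y (insertDec x (z ∷ l)) ∎
  where open ≡-Reasoning
... | inj₂ y<z | inj₂ x<z = begin
  insertDec x (insertDec y (z ∷ l)) ≡⟨ cong (insertDec x) (insertDec-> y<z l) ⟩
  insertDec x (z ∷ insertDec y l)   ≡⟨ insertDec-> x<z (insertDec y l) ⟩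
  z ∷ insertDec x (insertDec y l)   ≡⟨ cong (z ∷_) (insertDec-comm-≤ y≤x l) ⟩
  z ∷ insertDec y (insertDec x l)   ≡⟨ insertDec-> y<z (insertDec x l) ⟨
  insertDec y (z ∷ insertDec x l)   ≡⟨ cong (insertDec y) (insertDec-> x<z l) ⟨
  insertDec y (insertDec x (z ∷ l)) ∎
  where open ≡-Reasoning

insertDec-comm : ∀ x y l → insertDec x (insertDec y l) ≡ insertDec y (insertDec x l)
insertDec-comm x y l with ≤-or-> x y
... | inj₁ y≤x = insertDec-comm-≤ y≤x l
... | inj₂ x<y = sym (insertDec-comm-≤ (ℤₚ.<⇒≤ x<y) l)

sort-decreasing : ∀ {l} → WeaklyDecreasing l → sort l ≡ l
sort-decreasing [] = refl
sort-decreasing [-] = refl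
sort-decreasing {x ∷ y ∷ l} (y≤x ∷ l↘) rewrite sort-decreasing l↘ = insertDec-≤ y≤x l

insertDec-decreasing : ∀ x {l} → WeaklyDecreasing l → WeaklyDecreasing (insertDec x l)
insertDec-decreasing x [] = [-]
insertDec-decreasing x {y ∷ []} [-] with ≤-or-> x y
... | inj₁ y≤x rewrite insertDec-≤ y≤x [] = y≤x ∷ [-]
... | inj₂ x<y rewrite insertDec-> x<y [] = ℤₚ.<⇒≤ x<y ∷ [-]
insertDec-decreasing x {y ∷ z ∷ l} (z≤y ∷ l↘) with ≤-or-> x y
... | inj₁ y≤x rewrite insertDec-≤ y≤x (z ∷ l) = y≤x ∷ z≤y ∷ l↘
... | inj₂ x<y rewrite insertDec-> x<y (z ∷ l) with ≤-or-> x z | insertDec-decreasing x l↘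
...   | inj₁ z≤x | r↘ rewrite insertDec-≤ z≤x l = ℤₚ.<⇒≤ x<y ∷ r↘
...   | inj₂ x<z | r↘ rewrite insertDec-> x<z l = z≤y ∷ r↘

sort-↘ : ∀ l → WeaklyDecreasing (sort l)
sort-↘ [] = []
sort-↘ (x ∷ l) = insertDec-decreasing x (sort-↘ l)

-- Action of a raising operator on one letter.

-- The effect of e_i on a vector of ℤ^r, with coordinates numbered from 0.
data Raised : ℕ → List ℤ → List ℤ → Set where
  here  : ∀ {t l} → Raised 0 (t ∷ ℤ.suc t ∷ l) (ℤ.suc t ∷ t ∷ l)
  there : ∀ {i t l l′} → Raised i l l′ → Raised (suc i) (t ∷ l) (t ∷ l′)

coord : List ℤ → ℕ → ℤ
coord = at (+ 0)

raised-gain : ∀ {i l l′} → Raised i l l′ → coord l′ i ≡ ℤ.suc (coord l i)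
raised-gain here = refl
raised-gain (there ρ) = raised-gain ρ

raised-loss : ∀ {i l l′} → Raised i l l′ → ℤ.suc (coord l′ (suc i)) ≡ coord l (suc i)
raised-loss here = refl
raised-loss (there ρ) = raised-loss ρ

raised-other : ∀ {i l l′} → Raised i l l′ → ∀ {a} → a ≢ i → a ≢ suc i → coord l′ a ≡ coord l a
raised-other here {zero} a≢i _ = contradiction refl a≢i
raised-other here {suc zero} _ a≢si = contradiction refl a≢si
raised-other here {suc (suc a)} _ _ = refl
raised-other (there ρ) {zero} _ _ = refl
raised-other (there ρ) {suc a} a≢i a≢si =
  raised-other ρ (λ e → a≢i (cong suc e)) (λ e → a≢si (cong suc e))

-- When `P` has equal entries at the two places, the move swaps two adjacent entries of the sum, and
-- sorting does not see the swap.
sort-raised : ∀ {i l l′} → Raised i l l′ → ∀ P → length P ≡ length l →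
  coord P i ≡ coord P (suc i) → sort (P ⊕ l′) ≡ sort (P ⊕ l)
sort-raised here [] () _
sort-raised here (s ∷ []) () _
sort-raised (here {t} {l}) (s ∷ .s ∷ P) _ refl = insertDec-comm (s ℤ.+ ℤ.suc t) (s ℤ.+ t) (sort (P ⊕ l))
sort-raised (there ρ) [] () _
sort-raised (there {t = t} ρ) (s ∷ P) len e =
  cong (insertDec (s ℤ.+ t)) (sort-raised ρ P (ℕₚ.suc-injective len) e)

wt : ∀ {r} → Letter r → ℕ → ℤ
wt x = coord (eVec x)

entry : Bool → Bool → ℤ
entry s b = if b then (if s then -[1+ 0 ] else + 1) else + 0

wt-memb : ∀ {r} s (es : Vec Bool r) a → wt (letter s es) a ≡ entry s (memb (suc a) es)
wt-memb s [] zero = refl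
wt-memb s [] (suc a) = refl
wt-memb s (b ∷ es) zero = refl
wt-memb s (b ∷ es) (suc a) = wt-memb s es a

raised-pos : ∀ {r} i (es : Vec Bool r) → memb (suc i) es ≡ false → memb (suc (suc i)) es ≡ true →
  Raised i (eVec (letter false es)) (eVec (act (suc i) (letter false es)))
raised-pos zero (.false ∷ .true ∷ es) refl refl = here
raised-pos (suc i) (b ∷ es) p q = there (raised-pos i es p q)

raised-neg : ∀ {r} i (es : Vec Bool r) → suc i < r →
  memb (suc i) es ≡ true → memb (suc (suc i)) es ≡ false →
  Raised i (eVec (letter true es)) (eVec (act (suc i) (letter true es)))
raised-neg zero (_ ∷ []) (s≤s ()) _ _
raised-neg zero (.true ∷ .false ∷ es) _ refl refl = here
raised-neg (suc i) (b ∷ es) (s≤s i<r) p q = there (raised-neg i es i<r p q)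

-- A closing bracket means entries 0, 1 in a positive letter and -1, 0 in a negative one. Both are
-- the pattern `t`, `ℤ.suc t`, so the sign disappears from here on.
act-raised : ∀ {r} i (x : Letter r) → suc i < r → bracket (suc i) x ≡ cls →
  Raised i (eVec x) (eVec (act (suc i) x))
act-raised i (letter false es) i<r eq
  with memb (suc i) es in e₁ | memb (suc (suc i)) es in e₂
... | false | true = raised-pos i es e₁ e₂
act-raised i (letter false es) i<r () | false | false
act-raised i (letter false es) i<r () | true | false
act-raised i (letter false es) i<r () | true | true
act-raised i (letter true es) i<r eq
  with memb (suc i) es in e₁ | memb (suc (suc i)) es in e₂
... | true | false = raised-neg i es i<r e₁ e₂
act-raised i (letter true es) i<r () | false | false
act-raised i (letter true es) i<r () | false | true
act-raised i (letter true es) i<r () | true | true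

slope : Bracket → ℤ
slope opn = + 1
slope none = + 0
slope cls = -[1+ 0 ]

-- Links brackets to weights: summed over a prefix, the bracket balance becomes the difference of
-- two adjacent coordinates of the prefix weight.
slope-bracket : ∀ {r} i (x : Letter r) → slope (bracket (suc i) x) ≡ wt x i ℤ.- wt x (suc i)
slope-bracket i (letter s es) rewrite wt-memb s es i | wt-memb s es (suc i)
  with s | memb (suc i) es | memb (suc (suc i)) es
... | false | false | false = refl
... | false | false | true = refl
... | false | true | false = refl
... | false | true | true = refl
... | true | false | false = refl
... | true | false | true = refl
... | true | true | false = refl
... | true | true | true = refl

-- Prefix weights and bracket heights.

-- Past the end of the word it stays at the total weight, so that later statements can range over
-- all `k`.
prefixWt : ∀ {r} → List (Letter r) → ℕ → ℕ → ℤ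
prefixWt [] _ _ = + 0
prefixWt (x ∷ z) zero _ = + 0
prefixWt (x ∷ z) (suc k) a = wt x a ℤ.+ prefixWt z k a

height : ∀ {r} → ℕ → ℤ → List (Letter r) → ℕ → ℤ
height i h [] _ = h
height i h (x ∷ z) zero = h
height i h (x ∷ z) (suc k) = height i (h ℤ.+ slope (bracket i x)) z k

height-prefixWt : ∀ {r} i h (z : List (Letter r)) k →
  height (suc i) h z k ≡ h ℤ.+ (prefixWt z k i ℤ.- prefixWt z k (suc i))
height-prefixWt i h [] k = sym (ℤₚ.+-identityʳ h)
height-prefixWt i h (x ∷ z) zero = sym (ℤₚ.+-identityʳ h)
height-prefixWt i h (x ∷ z) (suc k)
  rewrite slope-bracket i x | height-prefixWt i (h ℤ.+ (wt x i ℤ.- wt x (suc i))) z k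
  = regroup h (wt x i) (wt x (suc i)) (prefixWt z k i) (prefixWt z k (suc i))
  where
  regroup : ∀ h a b c d → h ℤ.+ (a ℤ.- b) ℤ.+ (c ℤ.- d) ≡ h ℤ.+ (a ℤ.+ c ℤ.- (b ℤ.+ d))
  regroup = solve-∀

height-zero : ∀ {r} i h (z : List (Letter r)) → height i h z 0 ≡ h
height-zero i h [] = refl
height-zero i h (x ∷ z) = refl

data BracketAt {r} (i : ℕ) (b : Bracket) : ℕ → List (Letter r) → Set where
  here  : ∀ {x z} → bracket i x ≡ b → BracketAt i b 0 (x ∷ z)
  there : ∀ {q x z} → BracketAt i b q z → BracketAt i b (suc q) (x ∷ z)

-- A closing bracket met with no open bracket pending would bring the height to -1; hence the stored
-- candidate `m` is never replaced.
rightmostUnmatched-none : ∀ {r} i (z : List (Letter r)) idx φ m →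
  (∀ k → + 0 ℤ.≤ height i (+ φ) z k) → rightmostUnmatched i z idx φ m ≡ m
rightmostUnmatched-none i [] idx φ m h≥0 = refl
rightmostUnmatched-none i (x ∷ z) idx φ m h≥0 with bracket i x | (λ k → h≥0 (suc k))
... | opn | h = rightmostUnmatched-none i z (suc idx) (suc φ) m
  (subst (λ f → ∀ k → + 0 ℤ.≤ height i (+ f) z k) (ℕₚ.+-comm φ 1) h)
... | none | h = rightmostUnmatched-none i z (suc idx) φ m
  (subst (λ f → ∀ k → + 0 ℤ.≤ height i (+ f) z k) (ℕₚ.+-identityʳ φ) h)
... | cls | h with φ
...   | suc φ′ = rightmostUnmatched-none i z (suc idx) φ′ m h
...   | zero = contradiction (subst (+ 0 ℤ.≤_) (height-zero i _ z) (h 0)) λ ()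

record FirstDescent {r} (i : ℕ) (h : ℤ) (z : List (Letter r)) (q : ℕ) : Set where
  field
    closing     : BracketAt i cls q z
    nonnegative : ∀ k → k ≤ q → + 0 ℤ.≤ height i h z k
    zeroAt      : height i h z q ≡ + 0
    negativeAt  : height i h z (suc q) ≡ -[1+ 0 ]
open FirstDescent

firstDescent-∷ : ∀ {r} i h x {z : List (Letter r)} {q} → + 0 ℤ.≤ h →
  FirstDescent i (h ℤ.+ slope (bracket i x)) z q → FirstDescent i h (x ∷ z) (suc q)
firstDescent-∷ i h x h≥0 D .closing = there (closing D)
firstDescent-∷ i h x h≥0 D .nonnegative zero _ = h≥0
firstDescent-∷ i h x h≥0 D .nonnegative (suc k) (s≤s k≤q) = nonnegative D k k≤q
firstDescent-∷ i h x h≥0 D .zeroAt = zeroAt D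
firstDescent-∷ i h x h≥0 D .negativeAt = negativeAt D

firstDescent-here : ∀ {r} i x (z : List (Letter r)) → bracket i x ≡ cls → FirstDescent i (+ 0) (x ∷ z) 0
firstDescent-here i x z eq .closing = here eq
firstDescent-here i x z eq .nonnegative zero _ = ℤ.+≤+ z≤n
firstDescent-here i x z eq .zeroAt = refl
firstDescent-here i x z eq .negativeAt rewrite eq = height-zero i -[1+ 0 ] z

height-+ : ∀ {r} i h d (z : List (Letter r)) k → height i (h ℤ.+ d) z k ≡ height i h z k ℤ.+ d
height-+ i h d [] k = refl
height-+ i h d (x ∷ z) zero = refl
height-+ i h d (x ∷ z) (suc k) =
  trans (cong (λ g → height i g z k) (swap h d (slope (bracket i x))))
        (height-+ i (h ℤ.+ slope (bracket i x)) d z k)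
  where
  swap : ∀ h d s → h ℤ.+ d ℤ.+ s ≡ h ℤ.+ s ℤ.+ d
  swap = solve-∀

-- If the height never drops below −1, at most one "]" is unmatched, and it is the first descent to −1.
UnmatchedSpec : ∀ {r} → ℕ → List (Letter r) → (idx φ : ℕ) (m res : Maybe ℕ) → Set
UnmatchedSpec i z idx φ m res =
  (res ≡ m × (∀ k → + 0 ℤ.≤ height i (+ φ) z k)) ⊎
  (∃ λ q → res ≡ just (idx + q) × FirstDescent i (+ φ) z q)

unmatchedSpec-∷ : ∀ {r} i x {z : List (Letter r)} {idx φ φ′ m res} →
  + φ ℤ.+ slope (bracket i x) ≡ + φ′ →
  UnmatchedSpec i z (suc idx) φ′ m res → UnmatchedSpec i (x ∷ z) idx φ m res
unmatchedSpec-∷ i x {z} e (inj₁ (eq , h≥0)) = inj₁ (eq , λ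
  { zero → ℤ.+≤+ z≤n
  ; (suc k) → subst (λ h → + 0 ℤ.≤ height i h z k) (sym e) (h≥0 k) })
unmatchedSpec-∷ i x {z} {idx} {φ} e (inj₂ (q , eq , D)) =
  inj₂ (suc q , trans eq (cong just (sym (ℕₚ.+-suc idx q))) ,
    firstDescent-∷ i (+ φ) x (ℤ.+≤+ z≤n) (subst (λ h → FirstDescent i h z q) (sym e) D))

rightmostUnmatched-spec : ∀ {r} i (z : List (Letter r)) idx φ m →
  (∀ k → -[1+ 0 ] ℤ.≤ height i (+ φ) z k) →
  UnmatchedSpec i z idx φ m (rightmostUnmatched i z idx φ m)
rightmostUnmatched-spec i [] idx φ m h≥-1 = inj₁ (refl , λ _ → ℤ.+≤+ z≤n)
rightmostUnmatched-spec i (x ∷ z) idx φ m h≥-1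
  with bracket i x in eq | (λ k → h≥-1 (suc k))
... | opn | h =
  unmatchedSpec-∷ i x e
    (rightmostUnmatched-spec i z (suc idx) (suc φ) m
      (subst (λ f → ∀ k → -[1+ 0 ] ℤ.≤ height i f z k) e′ h))
  where
  e′ : + φ ℤ.+ + 1 ≡ + suc φ
  e′ = cong +_ (ℕₚ.+-comm φ 1)
  e : + φ ℤ.+ slope (bracket i x) ≡ + suc φ
  e = trans (cong (λ b → + φ ℤ.+ slope b) eq) e′
... | none | h =
  unmatchedSpec-∷ i x e
    (rightmostUnmatched-spec i z (suc idx) φ m
      (subst (λ f → ∀ k → -[1+ 0 ] ℤ.≤ height i f z k) e′ h))
  where
  e′ : + φ ℤ.+ + 0 ≡ + φ
  e′ = ℤₚ.+-identityʳ (+ φ)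
  e : + φ ℤ.+ slope (bracket i x) ≡ + φ
  e = trans (cong (λ b → + φ ℤ.+ slope b) eq) e′
... | cls | h with φ
...   | suc φ′ =
  unmatchedSpec-∷ i x (cong (λ b → + suc φ′ ℤ.+ slope b) eq) (rightmostUnmatched-spec i z (suc idx) φ′ m h)
-- After an unmatched bracket the scan restarts at height 0 instead of -1. Relative to this restart
-- the lower bound -1 becomes 0, so no later bracket is unmatched.
...   | zero = inj₂ (0 ,
    trans (rightmostUnmatched-none i z (suc idx) 0 (just idx) h≥0) (cong just (sym (ℕₚ.+-identityʳ idx))) ,
    firstDescent-here i x z eq)
    where
    h≥0 : ∀ k → + 0 ℤ.≤ height i (+ 0) z k
    h≥0 k = subst (+ 0 ℤ.≤_) (sym (height-+ i -[1+ 0 ] (+ 1) z k)) (ℤₚ.+-monoˡ-≤ (+ 1) (h k))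

-- One raising step in terms of prefix weights.

-- Passage from `p` to `p′` when `e_{i+1}` acts on letter `q`. The last three fields record the
-- bracketing rule: the balance is nonnegative up to `q`, zero at `q` and negative just after it.
-- Preservation of the invariant rests on these facts alone, without reference to words.
record Step (i q : ℕ) (p p′ : ℕ → ℕ → ℤ) : Set where
  field
    before   : ∀ {k} → k ≤ q → ∀ a → p′ k a ≡ p k a
    gain     : ∀ {k} → q < k → p′ k i ≡ ℤ.suc (p k i)
    loss     : ∀ {k} → q < k → ℤ.suc (p′ k (suc i)) ≡ p k (suc i)
    other    : ∀ {a} → a ≢ i → a ≢ suc i → ∀ k → p′ k a ≡ p k a
    dominant : ∀ {k} → k ≤ q → p k (suc i) ℤ.≤ p k i
    level    : p q i ≡ p q (suc i)
    descent  : p (suc q) i ℤ.< p (suc q) (suc i)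

prefixWt-applyAt-≤ : ∀ {r} f q (z : List (Letter r)) {k} → k ≤ q → ∀ a → prefixWt (applyAt q f z) k a ≡ prefixWt z k a
prefixWt-applyAt-≤ f q [] _ a = refl
prefixWt-applyAt-≤ f zero (x ∷ z) {zero} _ a = refl
prefixWt-applyAt-≤ f (suc q) (x ∷ z) {zero} _ a = refl
prefixWt-applyAt-≤ f (suc q) (x ∷ z) {suc k} (s≤s k≤q) a = cong (λ t → wt x a ℤ.+ t) (prefixWt-applyAt-≤ f q z k≤q a)

suc-+-comm : ∀ a b → ℤ.suc (a ℤ.+ b) ≡ a ℤ.+ ℤ.suc b
suc-+-comm a b = trans (sym (ℤₚ.+-assoc (+ 1) a b))
  (trans (cong (ℤ._+ b) (ℤₚ.+-comm (+ 1) a)) (ℤₚ.+-assoc a (+ 1) b))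

prefixWt-raised-gain : ∀ {r} i q (z : List (Letter r)) → suc i < r → BracketAt (suc i) cls q z →
  ∀ {k} → q < k → prefixWt (applyAt q (act (suc i)) z) k i ≡ ℤ.suc (prefixWt z k i)
prefixWt-raised-gain i zero (x ∷ z) i<r (here eq) {suc k} _
  rewrite raised-gain (act-raised i x i<r eq) = ℤₚ.+-assoc (+ 1) (wt x i) (prefixWt z k i)
prefixWt-raised-gain i (suc q) (x ∷ z) i<r (there B) {suc k} (s≤s q<k)
  rewrite prefixWt-raised-gain i q z i<r B q<k = sym (suc-+-comm (wt x i) (prefixWt z k i))

prefixWt-raised-loss : ∀ {r} i q (z : List (Letter r)) → suc i < r → BracketAt (suc i) cls q z →
  ∀ {k} → q < k → ℤ.suc (prefixWt (applyAt q (act (suc i)) z) k (suc i)) ≡ prefixWt z k (suc i)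
prefixWt-raised-loss i zero (x ∷ z) i<r (here eq) {suc k} _
  rewrite sym (raised-loss (act-raised i x i<r eq)) =
  sym (ℤₚ.+-assoc (+ 1) (wt (act (suc i) x) (suc i)) (prefixWt z k (suc i)))
prefixWt-raised-loss i (suc q) (x ∷ z) i<r (there B) {suc k} (s≤s q<k)
  rewrite sym (prefixWt-raised-loss i q z i<r B q<k) = suc-+-comm (wt x (suc i)) _

prefixWt-raised-other : ∀ {r} i q (z : List (Letter r)) → suc i < r → BracketAt (suc i) cls q z →
  ∀ {a} → a ≢ i → a ≢ suc i → ∀ k → prefixWt (applyAt q (act (suc i)) z) k a ≡ prefixWt z k a
prefixWt-raised-other i zero (x ∷ z) i<r (here eq) a≢i a≢si zero = refl
prefixWt-raised-other i zero (x ∷ z) i<r (here eq) {a} a≢i a≢si (suc k) =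
  cong (ℤ._+ prefixWt z k a) (raised-other (act-raised i x i<r eq) a≢i a≢si)
prefixWt-raised-other i (suc q) (x ∷ z) i<r (there B) a≢i a≢si zero = refl
prefixWt-raised-other i (suc q) (x ∷ z) i<r (there B) {a} a≢i a≢si (suc k) =
  cong (λ t → wt x a ℤ.+ t) (prefixWt-raised-other i q z i<r B a≢i a≢si k)

at-applyAt : ∀ {A : Set} (d : A) f q z {k} → k ≢ q → at d (applyAt q f z) k ≡ at d z k
at-applyAt d f q [] k≢q = refl
at-applyAt d f zero (x ∷ z) {zero} k≢q = contradiction refl k≢q
at-applyAt d f zero (x ∷ z) {suc k} k≢q = refl
at-applyAt d f (suc q) (x ∷ z) {zero} k≢q = refl
at-applyAt d f (suc q) (x ∷ z) {suc k} k≢q = at-applyAt d f q z (λ e → k≢q (cong suc e))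

at-raised : ∀ {r} (d : Letter r) i q z → suc i < r → BracketAt (suc i) cls q z →
  Raised i (eVec (at d z q)) (eVec (at d (applyAt q (act (suc i)) z) q))
at-raised d i zero (x ∷ z) i<r (here eq) = act-raised i x i<r eq
at-raised d i (suc q) (x ∷ z) i<r (there B) = at-raised d i q z i<r B

module _ {r} (i : ℕ) (i<r : suc i < r) (z : List (Letter r)) where

  private
    diff : ℕ → ℤ
    diff k = prefixWt z k i ℤ.- prefixWt z k (suc i)

    height-diff : ∀ k → height (suc i) (+ 0) z k ≡ diff k
    height-diff k = trans (height-prefixWt i (+ 0) z k) (ℤₚ.+-identityˡ (diff k))

  nonnegative⇒dominant : ∀ k → + 0 ℤ.≤ height (suc i) (+ 0) z k → prefixWt z k (suc i) ℤ.≤ prefixWt z k i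
  nonnegative⇒dominant k h = ℤₚ.0≤i-j⇒j≤i (subst (+ 0 ℤ.≤_) (height-diff k) h)

  firstDescent⇒step : ∀ {q} → FirstDescent (suc i) (+ 0) z q →
    Step i q (prefixWt z) (prefixWt (applyAt q (act (suc i)) z))
  firstDescent⇒step {q} D = record
    { before = prefixWt-applyAt-≤ _ q z
    ; gain = prefixWt-raised-gain i q z i<r (closing D)
    ; loss = prefixWt-raised-loss i q z i<r (closing D)
    ; other = prefixWt-raised-other i q z i<r (closing D)
    ; dominant = λ {k} k≤q → nonnegative⇒dominant k (nonnegative D k k≤q)
    ; level = ℤₚ.i-j≡0⇒i≡j _ _ (trans (sym (height-diff q)) (zeroAt D))
    ; descent = ℤₚ.≰⇒> λ ≥ → contradiction
        (subst (+ 0 ℤ.≤_) (trans (sym (height-diff (suc q))) (negativeAt D)) (ℤₚ.i≤j⇒0≤j-i ≥)) λ ()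
    }
    where open FirstDescent

  -- This bound says that the height never drops below -1, the situation of `UnmatchedSpec`: the
  -- operator acts at the first descent to -1, or gives 0 because there is none.
  module _ (nearly : ∀ k → prefixWt z k (suc i) ℤ.≤ ℤ.suc (prefixWt z k i)) where

    private
      spec : UnmatchedSpec (suc i) z 0 0 nothing (rightmostUnmatched (suc i) z 0 0 nothing)
      spec = rightmostUnmatched-spec (suc i) z 0 0 nothing λ k →
        subst (-[1+ 0 ] ℤ.≤_) (sym (height-diff k)) (lower k)
        where
        cancel : ∀ a b → ℤ.suc a ℤ.- b ≡ ℤ.suc (a ℤ.- b)
        cancel a b = ℤₚ.+-assoc (+ 1) a (ℤ.- b)
        lower : ∀ k → -[1+ 0 ] ℤ.≤ diff k
        lower k = subst (-[1+ 0 ] ℤ.≤_) (ℤₚ.pred-suc (diff k))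
          (ℤₚ.+-monoʳ-≤ -[1+ 0 ]
            (subst (+ 0 ℤ.≤_) (cancel (prefixWt z k i) (prefixWt z k (suc i))) (ℤₚ.i≤j⇒0≤j-i (nearly k))))

    raise-nothing : raise (suc i) z ≡ nothing → ∀ k → prefixWt z k (suc i) ℤ.≤ prefixWt z k i
    raise-nothing eq k with rightmostUnmatched (suc i) z 0 0 nothing | spec
    ... | _ | inj₁ (_ , h) = nonnegative⇒dominant k (h k)
    raise-nothing () k | _ | inj₂ (q , refl , D)

    raise-just : ∀ {q z′} → raise (suc i) z ≡ just (q , z′) →
      z′ ≡ applyAt q (act (suc i)) z × FirstDescent (suc i) (+ 0) z q
    raise-just eq with rightmostUnmatched (suc i) z 0 0 nothing | spec
    raise-just () | _ | inj₁ (refl , _)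
    raise-just refl | _ | inj₂ (q , refl , D) = refl , D

-- The invariant and its preservation.

-- The test is the one in `countApps`, so that accumulated counts and the log of operations are
-- compared by a single case split.
bump : ℕ → ℕ → (ℕ → ℕ → ℕ) → ℕ → ℕ → ℕ
bump i q M k j = if (j ≡ᵇ i) ∧ (k ≡ᵇ q) then suc (M k j) else M k j

≡ᵇ-refl : ∀ n → (n ≡ᵇ n) ≡ true
≡ᵇ-refl zero = refl
≡ᵇ-refl (suc n) = ≡ᵇ-refl n

≢⇒≡ᵇ-false : ∀ {m n} → m ≢ n → (m ≡ᵇ n) ≡ false
≢⇒≡ᵇ-false {m} {n} m≢n = dec-false (m ℕ.≟ n) m≢n

module _ (i q : ℕ) (M : ℕ → ℕ → ℕ) where

  bump-at : bump i q M q i ≡ suc (M q i)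
  bump-at rewrite ≡ᵇ-refl i | ≡ᵇ-refl q = refl

  bump-op≢ : ∀ {j} → j ≢ i → ∀ k → bump i q M k j ≡ M k j
  bump-op≢ j≢i k rewrite ≢⇒≡ᵇ-false j≢i = refl

  bump-position≢ : ∀ {k} → k ≢ q → ∀ j → bump i q M k j ≡ M k j
  bump-position≢ k≢q j rewrite ≢⇒≡ᵇ-false k≢q | ∧-zeroʳ (j ≡ᵇ i) = refl

  bump-≥ : ∀ k j → M k j ≤ bump i q M k j
  bump-≥ k j with (j ≡ᵇ i) ∧ (k ≡ᵇ q)
  ... | true = ℕₚ.n≤1+n _
  ... | false = ℕₚ.≤-refl

-- The unit that `p` moves from coordinate `suc i` to `i` moves the other way in the difference of
-- `μ` and `p`. The new values can be fixed outright as 0 and 1, because the old ones turn out to be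
-- 1 and 0 wherever this is applied.
shift : ℕ → (ℕ → ℕ) → ℕ → ℕ
shift i f a = if a ≡ᵇ i then 0 else (if a ≡ᵇ suc i then 1 else f a)

module _ (i : ℕ) (f : ℕ → ℕ) where

  shift-low : shift i f i ≡ 0
  shift-low rewrite ≡ᵇ-refl i = refl

  shift-high : shift i f (suc i) ≡ 1
  shift-high rewrite ≢⇒≡ᵇ-false (ℕₚ.1+n≢n {i}) | ≡ᵇ-refl i = refl

  shift-other : ∀ {a} → a ≢ i → a ≢ suc i → shift i f a ≡ f a
  shift-other a≢i a≢si rewrite ≢⇒≡ᵇ-false a≢i | ≢⇒≡ᵇ-false a≢si = refl

shiftAfter : ℕ → ℕ → (ℕ → ℕ → ℕ) → ℕ → ℕ → ℕ
shiftAfter i q χ k = if does (q ℕ.<? k) then shift i (χ k) else χ k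

-- μ k is the weight of the first k+1 letters of the lattice word (shifted by a constant), p k that of
-- the first k letters of the current word, and M k i counts the applications of e_i to letter k.
-- Coordinates are numbered from 0, so that e_{i+1} moves a unit from coordinate i+1 to coordinate i.
record Invariant (μ p : ℕ → ℕ → ℤ) (M : ℕ → ℕ → ℕ) : Set where
  field
    χ      : ℕ → ℕ → ℕ
    χ≤1    : ∀ k a → χ k a ≤ 1
    split  : ∀ k a → p k a ℤ.+ + χ k a ≡ μ k a
    flow   : ∀ k a → χ (suc k) a + M k (suc a) ≡ χ k a + M k a
    frozen : ∀ k i → 0 < M k (suc i) → ∀ {k′} → k′ ≤ k → p k′ (suc i) ℤ.≤ p k′ i
    level  : ∀ k i → 0 < M k (suc i) → p k i ≡ p k (suc i)
    source : ∀ k i → 0 < M k (suc i) → χ k i ≡ 0 → 0 < M k i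
    sink   : ∀ k i → 0 < M k (suc i) → χ k (suc i) ≡ 1 → 0 < M k (suc (suc i))

-- Since `p₁ < p₂` although the sums satisfy `μ₂ ≤ μ₁`, the summand `χ₁` must exceed `χ₂`; with both
-- at most 1, only 1 and 0 remain.
descent⇒χ : ∀ {p₁ p₂ μ₁ μ₂ χ₁ χ₂} → p₁ ℤ.+ + χ₁ ≡ μ₁ → p₂ ℤ.+ + χ₂ ≡ μ₂ → χ₁ ≤ 1 → χ₂ ≤ 1 →
  μ₂ ℤ.≤ μ₁ → p₁ ℤ.< p₂ → χ₁ ≡ 1 × χ₂ ≡ 0
descent⇒χ {χ₁ = 1} {0} _ _ _ _ _ _ = refl , refl
descent⇒χ {χ₁ = 0} {χ₂} refl refl _ _ μ₂≤μ₁ p₁<p₂ =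
  contradiction μ₂≤μ₁ (ℤₚ.<⇒≱ (ℤₚ.+-mono-<-≤ p₁<p₂ (ℤ.+≤+ z≤n)))
descent⇒χ {χ₁ = 1} {1} refl refl _ _ μ₂≤μ₁ p₁<p₂ =
  contradiction μ₂≤μ₁ (ℤₚ.<⇒≱ (ℤₚ.+-mono-<-≤ p₁<p₂ ℤₚ.≤-refl))
descent⇒χ {χ₁ = suc (suc _)} _ _ (s≤s ()) _ _ _
descent⇒χ {χ₁ = 1} {suc (suc _)} _ _ _ (s≤s ()) _ _

module _ {μ p M} (I : Invariant μ p M) where
  open Invariant I

  -- As `μ` is dominant and exceeds `p` by 0 or 1 in each coordinate, `p` fails dominance by at most
  -- one. This gives the bound -1 on heights.
  nearlyDominant : ∀ {i} k → μ k (suc i) ℤ.≤ μ k i → p k (suc i) ℤ.≤ ℤ.suc (p k i)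
  nearlyDominant {i} k dom = begin
    p k (suc i)                        ≤⟨ ℤₚ.i≤i+j (p k (suc i)) (+ χ k (suc i)) ⟩
    p k (suc i) ℤ.+ + χ k (suc i)      ≡⟨ split k (suc i) ⟩
    μ k (suc i)                        ≤⟨ dom ⟩
    μ k i                              ≡⟨ split k i ⟨
    p k i ℤ.+ + χ k i                  ≤⟨ ℤₚ.+-monoʳ-≤ (p k i) (ℤ.+≤+ (χ≤1 k i)) ⟩
    p k i ℤ.+ + 1                      ≡⟨ ℤₚ.+-comm (p k i) (+ 1) ⟩
    ℤ.suc (p k i)                      ∎
    where open ℤₚ.≤-Reasoning

  module _ {i q p′} (dom : ∀ k → μ k (suc i) ℤ.≤ μ k i) (S : Step i q p p′) where
    private
      module S = Step S

      M′ : ℕ → ℕ → ℕ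
      M′ = bump (suc i) q M

      -- If the operator had already acted on a letter after `q`, then `frozen` would make prefix
      -- `suc q` dominant at `i`, contrary to the descent there. So the positions at which a given
      -- operator acts never move to the left.
      unmoved : ∀ {k} → q < k → M k (suc i) ≡ 0
      unmoved {k} q<k with M k (suc i) in eq
      ... | zero = refl
      ... | suc m = contradiction (frozen k i (subst (0 <_) (sym eq) (s≤s z≤n)) q<k) (ℤₚ.<⇒≱ S.descent)

      -- No letter after q has been moved by e_i, so by flow χ can only fill i and empty i+1 there.
      χ-later : ∀ {k} → q < k → χ k i ≡ 1 × χ k (suc i) ≡ 0
      χ-later {suc k} (s≤s q≤k) with ℕₚ.m≤n⇒m<n∨m≡n q≤k
      ... | inj₂ refl = descent⇒χ (split (suc k) i) (split (suc k) (suc i))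
        (χ≤1 (suc k) i) (χ≤1 (suc k) (suc i)) (dom (suc k)) S.descent
      ... | inj₁ q<k with χ-later q<k | unmoved q<k
      ...   | e₁ , e₂ | m≡0 =
        ℕₚ.≤-antisym (χ≤1 (suc k) i) (subst (1 ≤_) (sym f₁) (s≤s z≤n)) ,
        ℕₚ.m+n≡0⇒m≡0 (χ (suc k) (suc i)) f₂
        where
        f₁ : χ (suc k) i ≡ 1 + M k i
        f₁ = begin
          χ (suc k) i               ≡⟨ ℕₚ.+-identityʳ _ ⟨
          χ (suc k) i + 0           ≡⟨ cong (λ t → χ (suc k) i + t) m≡0 ⟨
          χ (suc k) i + M k (suc i) ≡⟨ flow k i ⟩
          χ k i + M k i             ≡⟨ cong (_+ M k i) e₁ ⟩
          1 + M k i                 ∎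
          where open ≡-Reasoning
        f₂ : χ (suc k) (suc i) + M k (suc (suc i)) ≡ 0
        f₂ = trans (flow k (suc i)) (cong₂ _+_ e₂ m≡0)

      χ′ : ℕ → ℕ → ℕ
      χ′ = shiftAfter i q χ

      χ′-before : ∀ {k} → k ≤ q → χ′ k ≡ χ k
      χ′-before {k} k≤q rewrite dec-false (q ℕ.<? k) (ℕₚ.≤⇒≯ k≤q) = refl

      χ′-after : ∀ {k} → q < k → χ′ k ≡ shift i (χ k)
      χ′-after {k} q<k rewrite dec-true (q ℕ.<? k) q<k = refl

      χ′-low : ∀ {k} → q < k → χ′ k i ≡ 0
      χ′-low {k} q<k rewrite χ′-after q<k = shift-low i (χ k)

      χ′-high : ∀ {k} → q < k → χ′ k (suc i) ≡ 1
      χ′-high {k} q<k rewrite χ′-after q<k = shift-high i (χ k)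

      χ′-other : ∀ {a} → a ≢ i → a ≢ suc i → ∀ k → χ′ k a ≡ χ k a
      χ′-other {a} a≢i a≢si k with does (q ℕ.<? k)
      ... | true = shift-other i (χ k) a≢i a≢si
      ... | false = refl

      data Position (k a : ℕ) : Set where
        early : k ≤ q → Position k a
        low   : q < k → a ≡ i → Position k a
        high  : q < k → a ≡ suc i → Position k a
        far   : a ≢ i → a ≢ suc i → Position k a

      position : ∀ k a → Position k a
      position k a with k ℕ.≤? q | a ℕ.≟ i | a ℕ.≟ suc i
      ... | yes k≤q | _ | _ = early k≤q
      ... | no k≰q | yes a≡i | _ = low (ℕₚ.≰⇒> k≰q) a≡i
      ... | no k≰q | no _ | yes a≡si = high (ℕₚ.≰⇒> k≰q) a≡si
      ... | no k≰q | no a≢i | no a≢si = far a≢i a≢si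

      χ′≤1 : ∀ k a → χ′ k a ≤ 1
      χ′≤1 k a with position k a
      ... | early k≤q rewrite χ′-before k≤q = χ≤1 k a
      ... | low q<k refl rewrite χ′-low q<k = z≤n
      ... | high q<k refl rewrite χ′-high q<k = ℕₚ.≤-refl
      ... | far a≢i a≢si rewrite χ′-other a≢i a≢si k = χ≤1 k a

      split′ : ∀ k a → p′ k a ℤ.+ + χ′ k a ≡ μ k a
      split′ k a with position k a
      ... | early k≤q rewrite χ′-before k≤q | S.before k≤q a = split k a
      ... | far a≢i a≢si rewrite χ′-other a≢i a≢si k | S.other a≢i a≢si k = split k a
      ... | low q<k refl rewrite χ′-low q<k | S.gain q<k = begin
        ℤ.suc (p k i) ℤ.+ + 0 ≡⟨ ℤₚ.+-identityʳ _ ⟩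
        + 1 ℤ.+ p k i         ≡⟨ ℤₚ.+-comm (+ 1) (p k i) ⟩
        p k i ℤ.+ + 1         ≡⟨ cong (λ n → p k i ℤ.+ + n) (proj₁ (χ-later q<k)) ⟨
        p k i ℤ.+ + χ k i     ≡⟨ split k i ⟩
        μ k i                 ∎
        where open ≡-Reasoning
      ... | high q<k refl rewrite χ′-high q<k = begin
        p′ k (suc i) ℤ.+ + 1          ≡⟨ ℤₚ.+-comm (p′ k (suc i)) (+ 1) ⟩
        ℤ.suc (p′ k (suc i))          ≡⟨ S.loss q<k ⟩
        p k (suc i)                   ≡⟨ ℤₚ.+-identityʳ _ ⟨
        p k (suc i) ℤ.+ + 0           ≡⟨ cong (λ n → p k (suc i) ℤ.+ + n) (proj₂ (χ-later q<k)) ⟨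
        p k (suc i) ℤ.+ + χ k (suc i) ≡⟨ split k (suc i) ⟩
        μ k (suc i)                   ∎
        where open ≡-Reasoning

      i≢si : i ≢ suc i
      i≢si ()

      M′-later : ∀ {k} → q < k → ∀ j → M′ k j ≡ M k j
      M′-later q<k j = bump-position≢ (suc i) q M (λ e → ℕₚ.<⇒≢ q<k (sym e)) j

      M′-earlier : ∀ {k} → k < q → ∀ j → M′ k j ≡ M k j
      M′-earlier k<q j = bump-position≢ (suc i) q M (ℕₚ.<⇒≢ k<q) j

      -- Before `q` nothing changes. At `q` only the term at `suc k` changes in `χ`, by -1 at `i`
      -- and +1 at `suc i`, and the new application counted at `q` compensates for it. After `q`
      -- both sides change equally, as `χ-later` holds at `k` and at `suc k`.
      flow′ : ∀ k a → χ′ (suc k) a + M′ k (suc a) ≡ χ′ k a + M′ k a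
      flow′ k a with ℕₚ.<-cmp k q
      flow′ k a | tri< k<q _ _
        rewrite χ′-before k<q | χ′-before (ℕₚ.<⇒≤ k<q) | M′-earlier k<q a | M′-earlier k<q (suc a) = flow k a
      flow′ k a | tri≈ _ refl _ rewrite χ′-before (ℕₚ.≤-refl {q}) with position (suc q) a
      ... | early sq≤q = contradiction sq≤q (ℕₚ.<⇒≱ ℕₚ.≤-refl)
      ... | low q<sq refl
        rewrite χ′-low q<sq | bump-at (suc i) q M | bump-op≢ (suc i) q M i≢si q
        = trans (cong (_+ M q (suc i)) (sym (proj₁ (χ-later q<sq)))) (flow q i)
      ... | high q<sq refl
        rewrite χ′-high q<sq | bump-at (suc i) q M | bump-op≢ (suc i) q M (ℕₚ.1+n≢n {suc i}) q
        = trans (cong suc (trans (cong (_+ M q (suc (suc i))) (sym (proj₂ (χ-later q<sq)))) (flow q (suc i))))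
                (sym (ℕₚ.+-suc (χ q (suc i)) (M q (suc i))))
      ... | far a≢i a≢si
        rewrite χ′-other a≢i a≢si (suc q) | bump-op≢ (suc i) q M a≢si q
              | bump-op≢ (suc i) q M (λ e → a≢i (ℕₚ.suc-injective e)) q = flow q a
      flow′ k a | tri> _ _ q<k rewrite M′-later q<k a | M′-later q<k (suc a) with position k a
      ... | early k≤q = contradiction q<k (ℕₚ.≤⇒≯ k≤q)
      ... | low _ refl rewrite χ′-low q<k | χ′-low (ℕₚ.m≤n⇒m≤1+n q<k) =
        ℕₚ.suc-injective (subst₂ (λ x y → x + M k (suc i) ≡ y + M k i)
          (proj₁ (χ-later (ℕₚ.m≤n⇒m≤1+n q<k))) (proj₁ (χ-later q<k)) (flow k i))
      ... | high _ refl rewrite χ′-high q<k | χ′-high (ℕₚ.m≤n⇒m≤1+n q<k) =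
        cong suc (subst₂ (λ x y → x + M k (suc (suc i)) ≡ y + M k (suc i))
          (proj₂ (χ-later (ℕₚ.m≤n⇒m≤1+n q<k))) (proj₂ (χ-later q<k)) (flow k (suc i)))
      ... | far a≢i a≢si rewrite χ′-other a≢i a≢si k | χ′-other a≢i a≢si (suc k) = flow k a

      -- The cases in which the remaining clauses are rechecked. In `early` only prefixes up to `q`
      -- matter, and these are unchanged; in `far` the coordinates `j` and `suc j` both avoid `i`
      -- and `suc i`, so they are unchanged too.
      data Moved (k j : ℕ) : Set where
        new   : k ≡ q → j ≡ i → Moved k j
        early : k ≤ q → 0 < M k (suc j) → Moved k j
        far   : q < k → 0 < M k (suc j) → j ≢ i → j ≢ suc i → suc j ≢ i → Moved k j

      -- For k > q, source, sink and χ-later show that e_{i−1} or e_{i+1} moved letter k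
      -- only if e_i did, which unmoved excludes.
      moved : ∀ k j → 0 < M′ k (suc j) → Moved k j
      moved k j m>0 with k ℕ.≤? q
      moved k j m>0 | yes k≤q with k ℕ.≟ q | j ℕ.≟ i
      ... | yes k≡q | yes j≡i = new k≡q j≡i
      ... | no k≢q | _ = early k≤q (subst (0 <_) (bump-position≢ (suc i) q M k≢q (suc j)) m>0)
      ... | yes _ | no j≢i =
        early k≤q (subst (0 <_) (bump-op≢ (suc i) q M (λ e → j≢i (ℕₚ.suc-injective e)) k) m>0)
      moved k j m>0 | no k≰q =
        far q<k m₀>0
          (λ { refl → stuck m₀>0 })
          (λ { refl → stuck (source k (suc i) m₀>0 (proj₂ (χ-later q<k))) })
          (λ { refl → stuck (sink k j m₀>0 (proj₁ (χ-later q<k))) })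
        where
        q<k : q < k
        q<k = ℕₚ.≰⇒> k≰q
        m₀>0 : 0 < M k (suc j)
        m₀>0 = subst (0 <_) (M′-later q<k (suc j)) m>0
        stuck : ¬ 0 < M k (suc i)
        stuck h = ℕₚ.<-irrefl (sym (unmoved q<k)) h

      frozen′ : ∀ k j → 0 < M′ k (suc j) → ∀ {k′} → k′ ≤ k → p′ k′ (suc j) ℤ.≤ p′ k′ j
      frozen′ k j m>0 {k′} k′≤k with moved k j m>0
      ... | new refl refl rewrite S.before k′≤k i | S.before k′≤k (suc i) = S.dominant k′≤k
      ... | early k≤q m₀>0
        rewrite S.before (ℕₚ.≤-trans k′≤k k≤q) j | S.before (ℕₚ.≤-trans k′≤k k≤q) (suc j) = frozen k j m₀>0 k′≤k
      ... | far _ m₀>0 j≢i j≢si sj≢i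
        rewrite S.other j≢i j≢si k′ | S.other sj≢i (λ e → j≢i (ℕₚ.suc-injective e)) k′ = frozen k j m₀>0 k′≤k

      level′ : ∀ k j → 0 < M′ k (suc j) → p′ k j ≡ p′ k (suc j)
      level′ k j m>0 with moved k j m>0
      ... | new refl refl rewrite S.before (ℕₚ.≤-refl {q}) i | S.before (ℕₚ.≤-refl {q}) (suc i) = S.level
      ... | early k≤q m₀>0 rewrite S.before k≤q j | S.before k≤q (suc j) = level k j m₀>0
      ... | far _ m₀>0 j≢i j≢si sj≢i
        rewrite S.other j≢i j≢si k | S.other sj≢i (λ e → j≢i (ℕₚ.suc-injective e)) k = level k j m₀>0

      grown : ∀ {k j} → 0 < M k j → 0 < M′ k j
      grown {k} {j} h = ℕₚ.≤-trans h (bump-≥ (suc i) q M k j)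

      -- For the new application, `flow` at letter `q` decides: `χ (suc q) i` is 1, so if `χ q i` is
      -- 0 then `M q i` is `1 + M q (suc i)`.
      source′ : ∀ k j → 0 < M′ k (suc j) → χ′ k j ≡ 0 → 0 < M′ k j
      source′ k j m>0 with moved k j m>0
      ... | new refl refl rewrite χ′-before (ℕₚ.≤-refl {q}) = λ e → grown
        (subst (0 <_) (trans (cong (_+ M q (suc i)) (sym (proj₁ (χ-later ℕₚ.≤-refl))))
          (trans (flow q i) (cong (_+ M q i) e))) (s≤s z≤n))
      ... | early k≤q m₀>0 rewrite χ′-before k≤q = λ e → grown (source k j m₀>0 e)
      ... | far _ m₀>0 j≢i j≢si _ rewrite χ′-other j≢i j≢si k = λ e → grown (source k j m₀>0 e)

      -- Dually, `χ (suc q) (suc i)` is 0, so if `χ q (suc i)` is 1 then `M q (suc (suc i))` is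
      -- `1 + M q (suc i)`.
      sink′ : ∀ k j → 0 < M′ k (suc j) → χ′ k (suc j) ≡ 1 → 0 < M′ k (suc (suc j))
      sink′ k j m>0 with moved k j m>0
      ... | new refl refl rewrite χ′-before (ℕₚ.≤-refl {q}) = λ e → grown
        (subst (0 <_) (trans (cong (_+ M q (suc i)) (sym e))
          (trans (sym (flow q (suc i))) (cong (_+ M q (suc (suc i))) (proj₂ (χ-later ℕₚ.≤-refl))))) (s≤s z≤n))
      ... | early k≤q m₀>0 rewrite χ′-before k≤q = λ e → grown (sink k j m₀>0 e)
      ... | far _ m₀>0 j≢i _ sj≢i
        rewrite χ′-other sj≢i (λ e → j≢i (ℕₚ.suc-injective e)) k = λ e → grown (sink k j m₀>0 e)

    invariant-step : Invariant μ p′ M′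
    invariant-step = record
      { χ = χ′ ; χ≤1 = χ′≤1 ; split = split′ ; flow = flow′
      ; frozen = frozen′ ; level = level′ ; source = source′ ; sink = sink′ }

-- Words reached by raising operators.

emptyLetter : ∀ {r} → Letter r
emptyLetter = letter false (Vec.replicate _ false)

-- The letters y were changed into z by swaps that are invisible after adding a flat P and sorting.
Stable : ∀ {r} → List (Letter r) → List (Letter r) → (ℕ → ℕ → ℕ) → Set
Stable {r} y z M = ∀ k P → length P ≡ r → (∀ i → 0 < M k (suc i) → coord P i ≡ coord P (suc i)) →
  sort (P ⊕ eVec (at emptyLetter z k)) ≡ sort (P ⊕ eVec (at emptyLetter y k))

length-eVec : ∀ {r} (x : Letter r) → length (eVec x) ≡ r
length-eVec x = Vecₚ.length-toList (Vec.map _ (elems x))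

-- Counts only grow, so a `P` flat for the new counts is flat for the old ones; at letter `q` the
-- new count itself supplies the flatness that `sort-raised` asks for.
stable-step : ∀ {r} {y z : List (Letter r)} {M} {i q} → suc i < r → BracketAt (suc i) cls q z →
  Stable y z M → Stable y (applyAt q (act (suc i)) z) (bump (suc i) q M)
stable-step {z = z} {M} {i} {q} i<r B stable k P len flat =
  trans unchanged (stable k P len λ j m>0 → flat j (ℕₚ.≤-trans m>0 (bump-≥ (suc i) q M k (suc j))))
  where
  z′ = applyAt q (act (suc i)) z
  unchanged : sort (P ⊕ eVec (at emptyLetter z′ k)) ≡ sort (P ⊕ eVec (at emptyLetter z k))
  unchanged with k ℕ.≟ q
  ... | no k≢q = cong (λ x → sort (P ⊕ eVec x)) (at-applyAt emptyLetter (act (suc i)) q z k≢q)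
  ... | yes refl = sort-raised (at-raised emptyLetter i q z i<r B) P
    (trans len (sym (length-eVec (at emptyLetter z q))))
    (flat i (subst (0 <_) (sym (bump-at (suc i) q M)) (s≤s z≤n)))

InRange : ℕ → ℕ → Set
InRange r i = 1 ≤ i × i ≤ r ∸ 1

inRange-< : ∀ {r i} → i ≤ r ∸ 1 → 1 ≤ i → i < r
inRange-< {zero} z≤n ()
inRange-< {suc r} i≤r _ = s≤s i≤r

length-applyAt : ∀ {A : Set} q (f : A → A) z → length (applyAt q f z) ≡ length z
length-applyAt q f [] = refl
length-applyAt zero f (x ∷ z) = refl
length-applyAt (suc q) f (x ∷ z) = cong suc (length-applyAt q f z)

countApps-∷ : ∀ i q M k j lg →
  bump i q M k j + countApps j k lg ≡ M k j + countApps j k ((i , q) ∷ lg)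
countApps-∷ i q M k j lg with (j ≡ᵇ i) ∧ (k ≡ᵇ q)
... | true = sym (ℕₚ.+-suc (M k j) _)
... | false = refl

module _ {r : ℕ} (μ : ℕ → ℕ → ℤ) (dominant : ∀ {i} → suc i < r → ∀ k → μ k (suc i) ℤ.≤ μ k i)
         (y : List (Letter r)) where

  record Reached (M : ℕ → ℕ → ℕ) (z : List (Letter r)) : Set where
    field
      invariant : Invariant μ (prefixWt z) M
      stable    : Stable y z M
      length≡   : length z ≡ length y
  open Reached

  reached-raise : ∀ {M z} i {q z′} → InRange r i → Reached M z → raise i z ≡ just (q , z′) →
    Reached (bump i q M) z′
  reached-raise {M} {z} (suc i) (_ , i≤) R eq
    with i<r ← inRange-< i≤ (s≤s z≤n)
    with refl , D ← raise-just i i<r z (λ k → nearlyDominant (invariant R) k (dominant i<r k)) eq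
    = record
    { invariant = invariant-step (invariant R) (dominant i<r) (firstDescent⇒step i i<r z D)
    ; stable = stable-step {y = y} {z} {M} i<r (FirstDescent.closing D) (stable R)
    ; length≡ = trans (length-applyAt _ _ z) (length≡ R) }

  reached-applySeq : ∀ ops {M z lg z′} → All (InRange r) ops → Reached M z →
    applySeq ops z ≡ just (lg , z′) →
    ∃ λ M′ → Reached M′ z′ × (∀ k j → M′ k j ≡ M k j + countApps j k lg)
  reached-applySeq [] {M} [] R refl = M , R , λ k j → sym (ℕₚ.+-identityʳ (M k j))
  reached-applySeq (i ∷ ops) {M} {z} (i∈ ∷ ops∈) R eq with raise i z in eqʳ
  ... | just (q , z₁) with applySeq ops z₁ in eqˢ
  ...   | just (lg , z₂) with refl ← eq
    with M′ , R′ , count ← reached-applySeq ops ops∈ (reached-raise i i∈ R eqʳ) eqˢ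
    = M′ , R′ , λ k j → trans (count k j) (countApps-∷ i q M k j lg)

  -- The heights are at least -1 by `nearlyDominant`, and a highest weight word has no unmatched
  -- bracket, which excludes -1.
  reached-highestWeight : ∀ {M z} → Reached M z → HighestWeight r z →
    ∀ {i} → suc i < r → ∀ k → prefixWt z k (suc i) ℤ.≤ prefixWt z k i
  reached-highestWeight {M} {z} R hw {i} i<r =
    raise-nothing i i<r z (λ k → nearlyDominant (invariant R) k (dominant i<r k))
      (hw (suc i) (s≤s z≤n) (ℕₚ.<⇒≤pred i<r))

countApps-absent : ∀ {r} j (ops : List ℕ) {z z′ : List (Letter r)} {lg} → All (λ i → j ≢ i) ops →
  applySeq ops z ≡ just (lg , z′) → ∀ k → countApps j k lg ≡ 0
countApps-absent j [] [] refl k = refl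
countApps-absent j (i ∷ ops) {z} (j≢i ∷ j∉) eq k with raise i z
... | just (q , z₁) with applySeq ops z₁ in eqˢ
...   | just (lg , z₂) with refl ← eq rewrite ≢⇒≡ᵇ-false j≢i = countApps-absent j ops j∉ eqˢ k

-- Integer vectors through their coordinates.

length-zip : ∀ (f : ℤ → ℤ → ℤ) {r} P Q → length P ≡ r → length Q ≡ r → length (zipWith f P Q) ≡ r
length-zip f [] [] e _ = e
length-zip f [] (_ ∷ _) refl ()
length-zip f (_ ∷ _) [] refl ()
length-zip f (s ∷ P) (t ∷ Q) refl e = cong suc (length-zip f P Q refl (ℕₚ.suc-injective e))

-- The condition on `f` covers coordinates past the end, which `coord` reads as 0.
coord-zip : ∀ (f : ℤ → ℤ → ℤ) → f (+ 0) (+ 0) ≡ + 0 → ∀ P Q → length P ≡ length Q → ∀ a →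
  coord (zipWith f P Q) a ≡ f (coord P a) (coord Q a)
coord-zip f f0 [] [] _ a = sym f0
coord-zip f f0 (s ∷ P) (t ∷ Q) e zero = refl
coord-zip f f0 (s ∷ P) (t ∷ Q) e (suc a) = coord-zip f f0 P Q (ℕₚ.suc-injective e) a

coord-⊕ : ∀ P Q → length P ≡ length Q → ∀ a → coord (P ⊕ Q) a ≡ coord P a ℤ.+ coord Q a
coord-⊕ = coord-zip ℤ._+_ refl

coord-⊖ : ∀ P Q → length P ≡ length Q → ∀ a → coord (P ⊖ Q) a ≡ coord P a ℤ.- coord Q a
coord-⊖ = coord-zip ℤ._-_ refl

coord-injective : ∀ {r} P Q → length P ≡ r → length Q ≡ r → (∀ a → a < r → coord P a ≡ coord Q a) → P ≡ Q
coord-injective [] [] _ _ _ = refl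
coord-injective [] (_ ∷ _) refl () _
coord-injective (_ ∷ _) [] refl () _
coord-injective (s ∷ P) (t ∷ Q) refl e h =
  cong₂ _∷_ (h 0 (s≤s z≤n)) (coord-injective P Q refl (ℕₚ.suc-injective e) λ a a<r → h (suc a) (s≤s a<r))

length-zeroVec : ∀ r → length (zeroVec r) ≡ r
length-zeroVec r = Listₚ.length-replicate r

coord-zeroVec : ∀ r a → coord (zeroVec r) a ≡ + 0
coord-zeroVec zero a = refl
coord-zeroVec (suc r) zero = refl
coord-zeroVec (suc r) (suc a) = coord-zeroVec r a

coord⇒decreasing : ∀ P → (∀ i → suc i < length P → coord P (suc i) ℤ.≤ coord P i) → WeaklyDecreasing P
coord⇒decreasing [] h = []
coord⇒decreasing (s ∷ []) h = [-]
coord⇒decreasing (s ∷ t ∷ P) h =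
  h 0 (s≤s (s≤s z≤n)) ∷ coord⇒decreasing (t ∷ P) λ i i<r → h (suc i) (s≤s i<r)

decreasing⇒coord : ∀ {P} → WeaklyDecreasing P → ∀ i → suc i < length P → coord P (suc i) ℤ.≤ coord P i
decreasing⇒coord [-] i (s≤s ())
decreasing⇒coord (t≤s ∷ P↘) zero _ = t≤s
decreasing⇒coord (t≤s ∷ P↘) (suc i) (s≤s i<r) = decreasing⇒coord P↘ i i<r

-- Rows of the diagram and promotion.

after : ∀ {r} → List ℤ → List (Letter r) → ℕ → List ℤ
after A [] _ = A
after A (x ∷ z) zero = A
after A (x ∷ z) (suc k) = after (A ⊕ eVec x) z k

walk : ∀ {r} → List ℤ → List (Letter r) → List (List ℤ)
walk = scanl (λ A x → A ⊕ eVec x)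

module _ {r : ℕ} where

  length-⊕ : ∀ A (x : Letter r) → length A ≡ r → length (A ⊕ eVec x) ≡ r
  length-⊕ A x e = length-zip ℤ._+_ A (eVec x) e (length-eVec x)

  after-zero : ∀ A (z : List (Letter r)) → after A z 0 ≡ A
  after-zero A [] = refl
  after-zero A (x ∷ z) = refl

  after-suc : ∀ A (z : List (Letter r)) k → k < length z →
    after A z (suc k) ≡ after A z k ⊕ eVec (at emptyLetter z k)
  after-suc A (x ∷ z) zero _ = after-zero (A ⊕ eVec x) z
  after-suc A (x ∷ z) (suc k) (s≤s k<n) = after-suc (A ⊕ eVec x) z k k<n

  length-after : ∀ A (z : List (Letter r)) k → length A ≡ r → length (after A z k) ≡ r
  length-after A [] k e = e
  length-after A (x ∷ z) zero e = e
  length-after A (x ∷ z) (suc k) e = length-after (A ⊕ eVec x) z k (length-⊕ A x e)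

  coord-after : ∀ A (z : List (Letter r)) k → length A ≡ r → ∀ a →
    coord (after A z k) a ≡ coord A a ℤ.+ prefixWt z k a
  coord-after A [] k e a = sym (ℤₚ.+-identityʳ _)
  coord-after A (x ∷ z) zero e a = sym (ℤₚ.+-identityʳ _)
  coord-after A (x ∷ z) (suc k) e a = begin
    coord (after (A ⊕ eVec x) z k) a         ≡⟨ coord-after (A ⊕ eVec x) z k (length-⊕ A x e) a ⟩
    coord (A ⊕ eVec x) a ℤ.+ prefixWt z k a        ≡⟨ cong (ℤ._+ prefixWt z k a) (coord-⊕ A (eVec x) (trans e (sym (length-eVec x))) a) ⟩
    coord A a ℤ.+ wt x a ℤ.+ prefixWt z k a        ≡⟨ ℤₚ.+-assoc (coord A a) (wt x a) (prefixWt z k a) ⟩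
    coord A a ℤ.+ (wt x a ℤ.+ prefixWt z k a)      ∎
    where open ≡-Reasoning

  at-walk : ∀ A (z : List (Letter r)) k → k ≤ length z → at [] (walk A z) k ≡ after A z k
  at-walk A [] zero _ = refl
  at-walk A (x ∷ z) zero _ = refl
  at-walk A (x ∷ z) (suc k) (s≤s k≤n) = at-walk (A ⊕ eVec x) z k k≤n

  length-walk : ∀ A (z : List (Letter r)) → length (walk A z) ≡ suc (length z)
  length-walk A [] = refl
  length-walk A (x ∷ z) = cong suc (length-walk (A ⊕ eVec x) z)

  decreasing-after : ∀ A (z : List (Letter r)) → All WeaklyDecreasing (walk A z) →
    ∀ k → WeaklyDecreasing (after A z k)
  decreasing-after A [] (A↘ ∷ _) k = A↘
  decreasing-after A (x ∷ z) (A↘ ∷ _) zero = A↘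
  decreasing-after A (x ∷ z) (_ ∷ z↘) (suc k) = decreasing-after (A ⊕ eVec x) z z↘ k

  -- Promotion unrolled by one step: the freshly sorted vector becomes the initial vector of a
  -- shorter row, which allows induction along the row.
  promote-walk : ∀ q A B (z : List (Letter r)) →
    promote (q ∷ A ∷ walk B z) ≡ q ∷ promote (sort ((B ⊕ q) ⊖ A) ∷ walk B z)
  promote-walk q A B [] = refl
  promote-walk q A B (x ∷ z) = refl

  -- Turns the local rule of the diagram into adding the next letter of the old row to the last
  -- vector of the new row.
  ⊕-⊕-⊖ : ∀ q A (x : Letter r) → length q ≡ r → length A ≡ r →
    ((A ⊕ eVec x) ⊕ q) ⊖ A ≡ q ⊕ eVec x
  ⊕-⊕-⊖ q A x lq lA = coord-injective _ _
    (length-zip ℤ._-_ ((A ⊕ eVec x) ⊕ q) A lAxq lA) (length-⊕ q x lq) λ a _ → begin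
      coord (((A ⊕ eVec x) ⊕ q) ⊖ A) a             ≡⟨ coord-⊖ ((A ⊕ eVec x) ⊕ q) A (trans lAxq (sym lA)) a ⟩
      coord ((A ⊕ eVec x) ⊕ q) a ℤ.- coord A a     ≡⟨ cong (ℤ._- coord A a) (coord-⊕ (A ⊕ eVec x) q (trans lAx (sym lq)) a) ⟩
      coord (A ⊕ eVec x) a ℤ.+ coord q a ℤ.- coord A a
        ≡⟨ cong (λ t → t ℤ.+ coord q a ℤ.- coord A a) (coord-⊕ A (eVec x) (trans lA (sym (length-eVec x))) a) ⟩
      coord A a ℤ.+ wt x a ℤ.+ coord q a ℤ.- coord A a ≡⟨ cancel (coord A a) (wt x a) (coord q a) ⟩
      coord q a ℤ.+ wt x a                         ≡⟨ coord-⊕ q (eVec x) (trans lq (sym (length-eVec x))) a ⟨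
      coord (q ⊕ eVec x) a                         ∎
    where
    open ≡-Reasoning
    lAx = length-⊕ A x lA
    lAxq = length-zip ℤ._+_ (A ⊕ eVec x) q lAx lq
    cancel : ∀ s t u → s ℤ.+ t ℤ.+ u ℤ.- s ≡ u ℤ.+ t
    cancel = solve-∀

  -- The starting vectors `q` and `A` are arbitrary because both rows advance in the induction. The
  -- bound `k ≤ length y` stops one short of the last entry of the new row, which is prescribed
  -- rather than sorted.
  at-promote : ∀ (y z : List (Letter r)) q A → length z ≡ length y → length q ≡ r → length A ≡ r →
    (∀ k → k < length y → sort (after q z k ⊕ eVec (at emptyLetter y k)) ≡ after q z (suc k)) →
    ∀ k → k ≤ length y → at [] (promote (q ∷ walk A y)) k ≡ after q z k
  at-promote [] z q A _ _ _ _ zero _ = sym (after-zero q z)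
  at-promote (x ∷ y) z q A _ _ _ _ zero _ = sym (after-zero q z)
  at-promote (x ∷ y) (x′ ∷ z) q A lz lq lA chain (suc k) (s≤s k≤n)
    rewrite promote-walk q A (A ⊕ eVec x) y | ⊕-⊕-⊖ q A x lq lA
          | chain 0 (s≤s z≤n) | after-zero (q ⊕ eVec x′) z
    = at-promote y z (q ⊕ eVec x′) (A ⊕ eVec x) (ℕₚ.suc-injective lz) (length-⊕ q x′ lq) (length-⊕ A x lA)
        (λ k k<n → chain (suc k) (s≤s k<n)) k k≤n

promote-decreasing : ∀ {q l} → WeaklyDecreasing q → All WeaklyDecreasing l → All WeaklyDecreasing (promote (q ∷ l))
promote-decreasing q↘ [] = q↘ ∷ []
promote-decreasing q↘ (p↘ ∷ []) = q↘ ∷ p↘ ∷ []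
promote-decreasing {q} {p ∷ p₁ ∷ l} q↘ (p↘ ∷ p₁↘ ∷ l↘) = q↘ ∷ promote-decreasing (sort-↘ ((p₁ ⊕ q) ⊖ p)) (p₁↘ ∷ l↘)

length-promote : ∀ q l → length (promote (q ∷ l)) ≡ suc (length l)
length-promote q [] = refl
length-promote q (p ∷ []) = refl
length-promote q (p ∷ p₁ ∷ l) = cong suc (length-promote (sort ((p₁ ⊕ q) ⊖ p)) (p₁ ∷ l))

module _ {T : List (List ℤ)} where

  iterate-decreasing : ∀ u → All WeaklyDecreasing T → All WeaklyDecreasing (iter u promote T)
  iterate-decreasing zero T↘ = T↘
  iterate-decreasing (suc u) T↘ with iter u promote T | iterate-decreasing u T↘
  ... | [] | _ = []
  ... | _ ∷ _ | q↘ ∷ l↘ = promote-decreasing q↘ l↘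

  length-iterate : ∀ u → length (iter u promote T) ≡ length T
  length-iterate zero = refl
  length-iterate (suc u) with iter u promote T | length-iterate u
  ... | [] | e = e
  ... | q ∷ l | e = trans (length-promote q l) e

-- Combinations of the vectors e_{i+1} - e_i.

indicator : ℕ → ℕ → ℤ
indicator a b = if a ≡ᵇ b then + 1 else + 0

length-unitVec : ∀ r k → length (unitVec r k) ≡ r
length-unitVec zero k = refl
length-unitVec (suc r) zero = cong suc (length-unitVec r zero)
length-unitVec (suc r) (suc zero) = cong suc (length-zeroVec r)
length-unitVec (suc r) (suc (suc k)) = cong suc (length-unitVec r (suc k))

coord-unitVec : ∀ r k {a} → a < r → coord (unitVec r k) a ≡ indicator (suc a) k
coord-unitVec (suc r) zero {zero} _ = refl
coord-unitVec (suc r) zero {suc a} (s≤s a<r) = coord-unitVec r zero a<r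
coord-unitVec (suc r) (suc zero) {zero} _ = refl
coord-unitVec (suc r) (suc zero) {suc a} _ = coord-zeroVec r a
coord-unitVec (suc r) (suc (suc k)) {zero} _ = refl
coord-unitVec (suc r) (suc (suc k)) {suc a} (s≤s a<r) = coord-unitVec r (suc k) a<r

coord-scale : ∀ c P a → coord (scale c P) a ≡ c ℤ.* coord P a
coord-scale c [] a = sym (ℤₚ.*-zeroʳ c)
coord-scale c (t ∷ P) zero = refl
coord-scale c (t ∷ P) (suc a) = coord-scale c P a

pick : (ℕ → ℤ) → List ℕ → ℕ → ℤ
pick c [] b = + 0
pick c (i ∷ is) b = c i ℤ.* indicator b i ℤ.+ pick c is b

pick-∉ : ∀ c is {b} → All (λ i → b ≢ i) is → pick c is b ≡ + 0
pick-∉ c [] [] = refl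
pick-∉ c (i ∷ is) (b≢i ∷ b∉) rewrite ≢⇒≡ᵇ-false b≢i | ℤₚ.*-zeroʳ (c i) | pick-∉ c is b∉ = refl

pick-∈ : ∀ c {f : ℕ → ℕ} → (∀ {a b} → f a ≡ f b → a ≡ b) → ∀ {m k} → k < m →
  pick c (applyUpTo f m) (f k) ≡ c (f k)
pick-∈ c {f} inj {suc m} {zero} _
  rewrite ≡ᵇ-refl (f 0) | pick-∉ c _ (applyUpTo⁺₂ (λ i → f (suc i)) m λ i e → ℕₚ.0≢1+n (inj e))
  = trans (ℤₚ.+-identityʳ _) (ℤₚ.*-identityʳ _)
pick-∈ c {f} inj {suc m} {suc k} (s≤s k<m)
  rewrite ≢⇒≡ᵇ-false {f (suc k)} {f 0} (λ e → ℕₚ.1+n≢0 (inj e)) | ℤₚ.*-zeroʳ (c (f 0))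
  = trans (ℤₚ.+-identityˡ _) (pick-∈ c (λ e → ℕₚ.suc-injective (inj e)) k<m)

-- The vanishing of `c` at both ends lets one formula serve every coordinate, including the first
-- and the last.
pick-upTo : ∀ c m → c 0 ≡ + 0 → c (suc m) ≡ + 0 → ∀ {b} → b ≤ suc m → pick c (map suc (upTo m)) b ≡ c b
pick-upTo c m c₀ cₘ {b} b≤ rewrite Listₚ.map-upTo suc m = go b b≤
  where
  go : ∀ b → b ≤ suc m → pick c (applyUpTo suc m) b ≡ c b
  go zero _ = trans (pick-∉ c _ (applyUpTo⁺₂ suc m λ i ())) (sym c₀)
  go (suc b) (s≤s b≤m) with ℕₚ.m≤n⇒m<n∨m≡n b≤m
  ... | inj₁ b<m = pick-∈ c ℕₚ.suc-injective b<m
  ... | inj₂ refl = trans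
    (pick-∉ c _ (applyUpTo⁺₁ suc m λ i<m e → ℕₚ.<⇒≢ i<m (sym (ℕₚ.suc-injective e)))) (sym cₘ)

combination : ℕ → (ℕ → ℤ) → List ℕ → List ℤ
combination r c = foldr (λ i acc → scale (c i) (unitVec r (suc i) ⊖ unitVec r i) ⊕ acc) (zeroVec r)

module _ (r : ℕ) (c : ℕ → ℤ) where

  private
    root : ℕ → List ℤ
    root i = unitVec r (suc i) ⊖ unitVec r i

    length-root : ∀ i → length (scale (c i) (root i)) ≡ r
    length-root i = trans (Listₚ.length-map (c i ℤ.*_) (root i))
      (length-zip ℤ._-_ (unitVec r (suc i)) _ (length-unitVec r (suc i)) (length-unitVec r i))

  length-combination : ∀ is → length (combination r c is) ≡ r
  length-combination [] = length-zeroVec r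
  length-combination (i ∷ is) = length-zip ℤ._+_ (scale (c i) (root i)) (combination r c is)
    (length-root i) (length-combination is)

  -- Coordinate `a`, counted from 0, belongs to the basis vector e_{a+1}, which enters positively
  -- for `i = a` and negatively for `i = a + 1`.
  coord-combination : ∀ is {a} → a < r → coord (combination r c is) a ≡ pick c is a ℤ.- pick c is (suc a)
  coord-combination [] {a} _ = coord-zeroVec r a
  coord-combination (i ∷ is) {a} a<r = begin
    coord (combination r c (i ∷ is)) a
      ≡⟨ coord-⊕ (scale (c i) (root i)) (combination r c is) (trans (length-root i) (sym (length-combination is))) a ⟩
    coord (scale (c i) (root i)) a ℤ.+ coord (combination r c is) a
      ≡⟨ cong₂ ℤ._+_ (coord-scale (c i) (root i) a) (coord-combination is a<r) ⟩
    c i ℤ.* coord (root i) a ℤ.+ (pick c is a ℤ.- pick c is (suc a))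
      ≡⟨ cong (λ t → c i ℤ.* t ℤ.+ (pick c is a ℤ.- pick c is (suc a)))
          (trans (coord-⊖ (unitVec r (suc i)) (unitVec r i) (trans (length-unitVec r (suc i)) (sym (length-unitVec r i))) a)
                 (cong₂ ℤ._-_ (coord-unitVec r (suc i) a<r) (coord-unitVec r i a<r))) ⟩
    c i ℤ.* (indicator a i ℤ.- indicator (suc a) i) ℤ.+ (pick c is a ℤ.- pick c is (suc a))
      ≡⟨ regroup (c i) (indicator a i) (indicator (suc a) i) _ _ ⟩
    pick c (i ∷ is) a ℤ.- pick c (i ∷ is) (suc a) ∎
    where
    open ≡-Reasoning
    regroup : ∀ c s t u v → c ℤ.* (s ℤ.- t) ℤ.+ (u ℤ.- v) ≡ c ℤ.* s ℤ.+ u ℤ.- (c ℤ.* t ℤ.+ v)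
    regroup = solve-∀

-- Comparison of two consecutive rows.

-- The first letter has coordinates in {0, 1} or {−1, 0}: it is offset + fill with fill in {0, 1}.
offset : ∀ {r} → Letter r → ℤ
offset x = if neg x then -[1+ 0 ] else + 0

fill : ∀ {r} → Letter r → ℕ → ℕ
fill (letter false es) a = if memb (suc a) es then 1 else 0
fill (letter true es) a = if memb (suc a) es then 0 else 1

fill≤1 : ∀ {r} (x : Letter r) a → fill x a ≤ 1
fill≤1 (letter false es) a with memb (suc a) es
... | false = z≤n
... | true = ℕₚ.≤-refl
fill≤1 (letter true es) a with memb (suc a) es
... | false = ℕₚ.≤-refl
... | true = z≤n

wt-fill : ∀ {r} (x : Letter r) a → wt x a ≡ offset x ℤ.+ + fill x a
wt-fill (letter false es) a rewrite wt-memb false es a with memb (suc a) es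
... | false = refl
... | true = refl
wt-fill (letter true es) a rewrite wt-memb true es a with memb (suc a) es
... | false = refl
... | true = refl

+-cancelˡ-≤ : ∀ c {a b} → c ℤ.+ a ℤ.≤ c ℤ.+ b → a ℤ.≤ b
+-cancelˡ-≤ c {a} {b} h = subst₂ ℤ._≤_ (cancel c a) (cancel c b) (ℤₚ.+-monoʳ-≤ (ℤ.- c) h)
  where
  cancel : ∀ c a → ℤ.- c ℤ.+ (c ℤ.+ a) ≡ a
  cancel = solve-∀

module Row {r : ℕ} (x : Letter r) (y : List (Letter r))
           (decreasing : All WeaklyDecreasing (lambdas (x ∷ y))) where

  first : List ℤ
  first = zeroVec r ⊕ eVec x

  length-first : length first ≡ r
  length-first = length-⊕ (zeroVec r) x (length-zeroVec r)

  -- The row with the constant `offset x` removed. Dominance is unaffected, and `split` holds by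
  -- definition at the start, with `χ` constantly `fill x`.
  μ : ℕ → ℕ → ℤ
  μ k a = prefixWt y k a ℤ.+ + fill x a

  coord-row : ∀ k a → coord (after first y k) a ≡ offset x ℤ.+ μ k a
  coord-row k a = begin
    coord (after first y k) a       ≡⟨ coord-after first y k length-first a ⟩
    coord first a ℤ.+ prefixWt y k a
      ≡⟨ cong (ℤ._+ prefixWt y k a) (coord-⊕ (zeroVec r) (eVec x) (trans (length-zeroVec r) (sym (length-eVec x))) a) ⟩
    coord (zeroVec r) a ℤ.+ wt x a ℤ.+ prefixWt y k a
      ≡⟨ cong₂ (λ s t → s ℤ.+ t ℤ.+ prefixWt y k a) (coord-zeroVec r a) (wt-fill x a) ⟩
    + 0 ℤ.+ (offset x ℤ.+ + fill x a) ℤ.+ prefixWt y k a ≡⟨ regroup (offset x) (+ fill x a) (prefixWt y k a) ⟩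
    offset x ℤ.+ μ k a              ∎
    where
    open ≡-Reasoning
    regroup : ∀ s t u → + 0 ℤ.+ (s ℤ.+ t) ℤ.+ u ≡ s ℤ.+ (u ℤ.+ t)
    regroup = solve-∀

  dominant : ∀ {i} → suc i < r → ∀ k → μ k (suc i) ℤ.≤ μ k i
  dominant {i} i<r k = +-cancelˡ-≤ (offset x) (subst₂ ℤ._≤_ (coord-row k (suc i)) (coord-row k i)
    (decreasing⇒coord (decreasing-after first y (All.tail decreasing) k) i
      (subst (suc i <_) (sym (length-after first y k length-first)) i<r)))

  start : Reached μ dominant y (λ _ _ → 0) y
  start = record
    { invariant = record
      { χ = λ _ → fill x
      ; χ≤1 = λ _ → fill≤1 x
      ; split = λ _ _ → refl
      ; flow = λ _ _ → refl
      ; frozen = λ _ _ ()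
      ; level = λ _ _ ()
      ; source = λ _ _ ()
      ; sink = λ _ _ () }
    ; stable = λ _ _ _ _ → refl
    ; length≡ = refl }

  module End {M : ℕ → ℕ → ℕ} {z : List (Letter r)} (R : Reached μ dominant y M z) (hw : HighestWeight r z) where
    open Reached R
    open Invariant invariant

    zeros : List ℤ
    zeros = zeroVec r

    coord-end : ∀ k a → coord (after zeros z k) a ≡ prefixWt z k a
    coord-end k a = trans (coord-after zeros z k (length-zeroVec r) a)
      (trans (cong (ℤ._+ prefixWt z k a) (coord-zeroVec r a)) (ℤₚ.+-identityˡ _))

    length-end : ∀ k → length (after zeros z k) ≡ r
    length-end k = length-after zeros z k (length-zeroVec r)

    decreasing-end : ∀ k → WeaklyDecreasing (after zeros z k)
    decreasing-end k = coord⇒decreasing _ λ i i<r →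
      subst₂ ℤ._≤_ (sym (coord-end k (suc i))) (sym (coord-end k i))
        (reached-highestWeight μ dominant y R hw (subst (suc i <_) (length-end k) i<r) k)

    -- By `level` the prefix is flat wherever letter `k` was moved, so `stable` trades the letter of
    -- `y` for that of `z`; the resulting prefix is decreasing by highest weight, hence fixed by
    -- `sort`.
    chain : ∀ k → k < length y → sort (after zeros z k ⊕ eVec (at emptyLetter y k)) ≡ after zeros z (suc k)
    chain k k<n = begin
      sort (after zeros z k ⊕ eVec (at emptyLetter y k))
        ≡⟨ stable k (after zeros z k) (length-end k)
             (λ i m>0 → trans (coord-end k i) (trans (level k i m>0) (sym (coord-end k (suc i))))) ⟨
      sort (after zeros z k ⊕ eVec (at emptyLetter z k))
        ≡⟨ cong sort (after-suc zeros z k (subst (k <_) (sym length≡) k<n)) ⟨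
      sort (after zeros z (suc k)) ≡⟨ sort-decreasing (decreasing-end (suc k)) ⟩
      after zeros z (suc k) ∎
      where open ≡-Reasoning

    at-row : ∀ k → k ≤ length y → at [] (lambdas (x ∷ y)) (suc k) ≡ after first y k
    at-row k k≤n = at-walk first y k k≤n

    at-promoted : ∀ k → k ≤ length y → at [] (promote (lambdas (x ∷ y))) k ≡ after zeros z k
    at-promoted = at-promote y z zeros first length≡ (length-zeroVec r) length-first chain

    -- The difference of the two rows in one column: `gap (j ∸ 1)` is e_A and `gap j` is e_B.
    gap : ℕ → List ℤ
    gap k = after first y k ⊖ after zeros z k

    length-gap : ∀ k → length (gap k) ≡ r
    length-gap k = length-zip ℤ._-_ (after first y k) _ (length-after first y k length-first) (length-end k)

    coord-gap : ∀ k a → coord (gap k) a ≡ offset x ℤ.+ + χ k a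
    coord-gap k a = begin
      coord (gap k) a
        ≡⟨ coord-⊖ (after first y k) _ (trans (length-after first y k length-first) (sym (length-end k))) a ⟩
      coord (after first y k) a ℤ.- coord (after zeros z k) a ≡⟨ cong₂ ℤ._-_ (coord-row k a) (coord-end k a) ⟩
      offset x ℤ.+ μ k a ℤ.- prefixWt z k a                         ≡⟨ cong (λ t → offset x ℤ.+ t ℤ.- prefixWt z k a) (split k a) ⟨
      offset x ℤ.+ (prefixWt z k a ℤ.+ + χ k a) ℤ.- prefixWt z k a         ≡⟨ cancel (offset x) (prefixWt z k a) (+ χ k a) ⟩
      offset x ℤ.+ + χ k a                                     ∎
      where
      open ≡-Reasoning
      cancel : ∀ s t u → s ℤ.+ (t ℤ.+ u) ℤ.- t ≡ s ℤ.+ u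
      cancel = solve-∀

    -- Coordinate by coordinate this is `flow`: the change of `χ` at `a` is `M k a` minus
    -- `M k (suc a)`, just the coordinate of the combination.
    gap-suc : ∀ k (c : ℕ → ℤ) → (∀ i → c i ≡ + M k i) → c 0 ≡ + 0 → (∀ i → r ≤ i → c i ≡ + 0) →
      gap (suc k) ≡ gap k ⊕ combination r c (map suc (upTo (r ∸ 1)))
    gap-suc k c c≡M c₀ cᵣ = coord-injective _ _ (length-gap (suc k))
      (length-zip ℤ._+_ (gap k) _ (length-gap k) (length-combination r c is)) λ a a<r → begin
        coord (gap (suc k)) a ≡⟨ coord-gap (suc k) a ⟩
        offset x ℤ.+ + χ (suc k) a ≡⟨ balance (offset x) {+ χ (suc k) a} {+ M k (suc a)} {+ χ k a} {+ M k a}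
               (cong +_ (flow k a)) ⟩
        offset x ℤ.+ + χ k a ℤ.+ (+ M k a ℤ.- + M k (suc a))
          ≡⟨ cong₂ (λ s t → s ℤ.+ t) (coord-gap k a) (cong₂ ℤ._-_ (c≡M a) (c≡M (suc a))) ⟨
        coord (gap k) a ℤ.+ (c a ℤ.- c (suc a))
          ≡⟨ cong (λ t → coord (gap k) a ℤ.+ t) (coord-is a<r) ⟨
        coord (gap k) a ℤ.+ coord (combination r c is) a
          ≡⟨ coord-⊕ (gap k) _ (trans (length-gap k) (sym (length-combination r c is))) a ⟨
        coord (gap k ⊕ combination r c is) a ∎
      where
      open ≡-Reasoning
      is = map suc (upTo (r ∸ 1))
      coord-is : ∀ {a} → a < r → coord (combination r c is) a ≡ c a ℤ.- c (suc a)
      coord-is {a} a<r@(s≤s {n = r-1} a≤) = trans (coord-combination r c is a<r)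
        (cong₂ ℤ._-_ (pick-upTo c r-1 c₀ (cᵣ _ ℕₚ.≤-refl) (ℕₚ.m≤n⇒m≤1+n a≤))
                   (pick-upTo c r-1 c₀ (cᵣ _ ℕₚ.≤-refl) (s≤s a≤)))
      balance : ∀ s {t u v w} → t ℤ.+ u ≡ v ℤ.+ w → s ℤ.+ t ≡ s ℤ.+ v ℤ.+ (w ℤ.- u)
      balance s {t} {u} {v} {w} e = trans (lhs s t u) (trans (cong (λ e → s ℤ.+ e ℤ.- u) e) (rhs s u v w))
        where
        lhs : ∀ s t u → s ℤ.+ t ≡ s ℤ.+ (t ℤ.+ u) ℤ.- u
        lhs = solve-∀
        rhs : ∀ s u v w → s ℤ.+ (v ℤ.+ w) ℤ.- u ≡ s ℤ.+ v ℤ.+ (w ℤ.- u)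
        rhs = solve-∀

    recurrence : ∀ k (c : ℕ → ℤ) → (∀ i → c i ≡ + M k i) → c 0 ≡ + 0 → (∀ i → r ≤ i → c i ≡ + 0) →
      suc k ≤ length y →
      at [] (lambdas (x ∷ y)) (suc (suc k)) ⊖ at [] (promote (lambdas (x ∷ y))) (suc k) ≡
      (at [] (lambdas (x ∷ y)) (suc k) ⊖ at [] (promote (lambdas (x ∷ y))) k) ⊕
        combination r c (map suc (upTo (r ∸ 1)))
    recurrence k c c≡M c₀ cᵣ k<n = trans (at-gap (suc k) k<n) (trans (gap-suc k c c≡M c₀ cᵣ)
      (cong (λ P → P ⊕ combination r c (map suc (upTo (r ∸ 1)))) (sym (at-gap k (ℕₚ.<⇒≤ k<n)))))
      where
      at-gap : ∀ k → k ≤ length y → at [] (lambdas (x ∷ y)) (suc k) ⊖ at [] (promote (lambdas (x ∷ y))) k ≡ gap k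
      at-gap k k≤n = cong₂ _⊖_ (at-row k k≤n) (at-promoted k k≤n)

-- Column indices and conclusion.

<ᵇ-true : ∀ {m n} → m < n → (m ℕ.<ᵇ n) ≡ true
<ᵇ-true {m} {n} m<n = dec-true (m ℕ.<? n) m<n

<ᵇ-false : ∀ {m n} → n ≤ m → (m ℕ.<ᵇ n) ≡ false
<ᵇ-false {m} {n} n≤m = dec-false (m ℕ.<? n) (ℕₚ.≤⇒≯ n≤m)

-- If `v` exceeded `u + j`, the difference would be positive and below `n`. Otherwise `u + j ∸ v` is
-- a multiple of `n`: quotient 0 gives `v = u + j > u`, quotient 1 gives `v + n = u + j` with
-- `v ≤ u`, and larger quotients are excluded by `u + j < 2n`.
column-index : ∀ {n u j v} → u ≤ n → 1 ≤ j → j ≤ n ∸ 1 → 1 ≤ v → v ≤ n → (+ n) ∣ (+ v ℤ.- + (u + j)) →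
  (if u ℕ.<ᵇ v then v else v + n) ≡ u + j
column-index {zero} u≤n 1≤j j≤ 1≤v v≤n n∣ = contradiction (ℕₚ.≤-trans 1≤v v≤n) λ ()
column-index {n@(suc n-1)} {u} {j} {v} u≤n 1≤j j≤ 1≤v v≤n n∣ with v ℕ.≤? u + j
... | no v≰ = contradiction (ℕᵈ.∣⇒≤ {{ℕ.>-nonZero (ℕₚ.m<n⇒0<n∸m v>)}} n∣v∸s)
                (ℕₚ.<⇒≱ (ℕₚ.<-≤-trans (ℕₚ.∸-monoʳ-< {v} {u + j} {0} (ℕₚ.≤-trans 1≤j (ℕₚ.m≤n+m j u)) (ℕₚ.<⇒≤ v>)) v≤n))
  where
  v> : u + j < v
  v> = ℕₚ.≰⇒> v≰
  n∣v∸s = subst (λ d → n ℕᵈ.∣ d)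
    (trans (cong ℤ.∣_∣ (ℤₚ.m-n≡m⊖n v (u + j))) (cong ℤ.∣_∣ (ℤₚ.⊖-≥ (ℕₚ.<⇒≤ v>)))) n∣
... | yes v≤ with subst (λ d → n ℕᵈ.∣ d)
    (trans (cong ℤ.∣_∣ (ℤₚ.m-n≡m⊖n v (u + j))) (ℤₚ.∣⊖∣-≤ v≤)) n∣
...   | ℕᵈ.divides zero e = trans (cong (λ b → if b then v else v + n) (<ᵇ-true u<v)) v≡
  where
  v≡ : v ≡ u + j
  v≡ = ℕₚ.≤-antisym v≤ (ℕₚ.m∸n≡0⇒m≤n e)
  u<v : u < v
  u<v = subst (u <_) (sym v≡) (ℕₚ.m<m+n u 1≤j)
...   | ℕᵈ.divides (suc zero) e = trans (cong (λ b → if b then v else v + n) (<ᵇ-false v≤u)) v+n≡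
  where
  v+n≡ : v + n ≡ u + j
  v+n≡ = trans (cong (λ t → v + t) (trans (sym (ℕₚ.+-identityʳ n)) (sym e))) (ℕₚ.m+[n∸m]≡n v≤)
  v≤u : v ≤ u
  v≤u = ℕₚ.+-cancelʳ-≤ n v u (subst (_≤ u + n) (sym v+n≡) (ℕₚ.+-monoʳ-≤ u (ℕₚ.m≤n⇒m≤1+n j≤)))
...   | ℕᵈ.divides (suc (suc q)) e = contradiction
    (subst (_≤ n + n-1) e (ℕₚ.≤-trans (ℕₚ.m∸n≤m (u + j) v) (ℕₚ.+-mono-≤ u≤n j≤)))
    (ℕₚ.<⇒≱ (ℕₚ.+-monoʳ-< n (ℕₚ.m≤m+n n (q ℕ.* n))))

length-latticeWord : ∀ {r n T} u → IsNonSkewFT r n T → (w : List (Letter r)) →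
  IsLatticeWord w (iter u promote T) → length w ≡ n
length-latticeWord {r} {n} {T} u (w₀ , len₀ , lat₀ , _) w lat = ℕₚ.suc-injective (begin
  suc (length w)             ≡⟨ length-walk (zeroVec r) w ⟨
  length (lambdas w)         ≡⟨ cong length lat ⟩
  length (iter u promote T)  ≡⟨ length-iterate u ⟩
  length T                   ≡⟨ cong length lat₀ ⟨
  length (lambdas w₀)        ≡⟨ length-walk (zeroVec r) w₀ ⟩
  suc (length w₀)            ≡⟨ cong suc len₀ ⟩
  suc n                      ∎)
  where open ≡-Reasoning

row-recurrence : ∀ {r} {row : List (List ℤ)} (x : Letter r) y → IsLatticeWord (x ∷ y) row → All WeaklyDecreasing row →
  ∀ ops {lg w′} → All (InRange r) ops → applySeq ops y ≡ just (lg , w′) → HighestWeight r w′ →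
  ∀ k → suc k ≤ length y →
  at [] row (suc (suc k)) ⊖ at [] (promote row) (suc k) ≡
  (at [] row (suc k) ⊖ at [] (promote row) k) ⊕
    combination r (λ i → + countApps i k lg) (map suc (upTo (r ∸ 1)))
row-recurrence {r} x y refl row↘ ops {lg} ops∈ eq hw k k<n =
  let M , R , count = reached-applySeq (Row.μ x y row↘) (Row.dominant x y row↘) y ops ops∈ (Row.start x y row↘) eq
  in Row.End.recurrence x y row↘ R hw k _ (λ i → cong +_ (sym (count k i)))
       -- Operators have indices from 1 to `r ∸ 1`, so the counts vanish at 0 and from `r` on.
       (absent 0 λ { (() , _) refl })
       (λ i r≤i → absent i λ { (1≤i , i≤) refl → ℕₚ.<⇒≱ (inRange-< i≤ 1≤i) r≤i })
       k<n
  where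
  absent : ∀ j → (∀ {i} → InRange r i → j ≢ i) → + countApps j k lg ≡ + 0
  absent j j∉ = cong +_ (countApps-absent j ops (All.map j∉ ops∈) eq k)

theorem8p24 : (r n : ℕ) (T : List (List ℤ)) → IsNonSkewFT r n T →
    (u j v : ℕ) → 1 ≤ u → u ≤ n → 1 ≤ j → j ≤ n ∸ 1 → 1 ≤ v → v ≤ n →
    (+ n) ∣ (+ v - + (u + j)) →
    (w : List (Letter r)) → IsLatticeWord w (iter (u ∸ 1) promote T) →
    (ops : List ℕ) → All (λ i → 1 ≤ i × i ≤ r ∸ 1) ops →
    (lg : List (ℕ × ℕ)) (w′ : List (Letter r)) →
    applySeq ops (drop 1 w) ≡ just (lg , w′) → HighestWeight r w′ →
    IsReducedM r n T u v (λ i → + countApps i (j ∸ 1) lg)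
theorem8p24 r n T ft (suc u) j v _ u≤n 1≤j j≤ 1≤v v≤n n∣ [] lat ops ops∈ lg w′ eq hw =
  -- An empty lattice word would force `n` to be 0.
  contradiction (subst (suc u ≤_) (sym (length-latticeWord u ft [] lat)) u≤n) λ ()
theorem8p24 r n T ft (suc u) (suc k) v _ u≤n 1≤j j≤ 1≤v v≤n n∣ (x ∷ y) lat ops ops∈ lg w′ eq hw =
  subst Goal (sym (column-index {u = suc u} {v = v} u≤n 1≤j j≤ 1≤v v≤n n∣)) goal
  where
  rhs : List ℤ → List ℤ
  rhs P = P ⊕ combination r (λ i → + countApps i k lg) (map suc (upTo (r ∸ 1)))

  Goal : ℕ → Set
  Goal j′ = diag T u j′ ⊖ diag T (suc u) j′ ≡ rhs (diag T u (j′ ∸ 1) ⊖ diag T (suc u) (j′ ∸ 1))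

  -- A row starts in the column with its own number, so column `suc u + suc k` is entry
  -- `suc (suc k)` of row `u` and entry `suc k` of row `suc u`; the preceding column gives entries
  -- `suc k` and `k`.
  index₁ : suc (u + suc k) ∸ u ≡ suc (suc k)
  index₁ = trans (cong (_∸ u) (sym (ℕₚ.+-suc u (suc k)))) (ℕₚ.m+n∸m≡n u (suc (suc k)))

  index₂ : (u + suc k) ∸ suc u ≡ k
  index₂ = trans (cong (_∸ suc u) (ℕₚ.+-suc u k)) (ℕₚ.m+n∸m≡n u k)

  goal : Goal (suc u + suc k)
  goal rewrite index₁ | ℕₚ.m+n∸m≡n u (suc k) | index₂ =
    row-recurrence x y lat (iterate-decreasing u (proj₂ (proj₂ (proj₂ ft)))) ops ops∈ eq hw k
      (subst (λ m → suc k ≤ m ∸ 1) (sym (length-latticeWord u ft (x ∷ y) lat)) j≤)
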